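{- For each complete folding sequence $S$, there exists a complete folding curve $D$ whose associated sequence is locally isomorphic to $S$ and such that $\{D\}$ is a covering of $\mathbb{R}^2$, i.e. every edge $[(x,y),(x+1,y)]$ or $[(x,y),(x,y+1)]$ with $x,y\in\mathbb{Z}$ is the support of exactly one segment of $D$.
   Context: All sequences take values in $\{+1,-1\}$. For $S=(a_1,\dots,a_n)$ write $\overline{S}=(-a_n,\dots,-a_1)$. The $n$-folding sequences are defined recursively: the only $0$-folding sequence is the empty sequence, and the $(n+1)$-folding sequences are exactly $(\overline{S},+1,S)$ and $(\overline{S},-1,S)$ with $S$ an $n$-folding sequence. A subword of a sequence $(b_k)$ is a block $(b_{h+1},\dots,b_{h+m})$. A complete folding sequence is a sequence $(a_k)_{k\in\mathbb{Z}}$ each finite subword of which is a subword of some $n$-folding sequence. Two sequences indexed by $\mathbb{Z}$ are locally isomorphic if they have the same finite subwords. A segment is an oriented unit edge of $\mathbb{Z}^2$. A complete curve is a sequence $(C_i)_{i\in\mathbb{Z}}$ of segments such that the terminal point of $C_i$ is the initial point of $C_{i+1}$, consecutive supports are perpendicular, and all supports are pairwise distinct; its associated sequence is $(\eta_i)_{i\in\mathbb{Z}}$ with $\eta_i=+1$ (resp. $-1$) if one turns left (resp. right) from $C_i$ to $C_{i+1}$. A complete folding curve is a complete curve whose associated sequence is a complete folding sequence. -}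

module Defs where

open import Data.Nat using (ℕ; zero; suc)
open import Data.Integer using (ℤ; _+_; _-_; 0ℤ; 1ℤ)
open import Data.List using (List; []; _∷_; _++_; reverse; map)
open import Data.Product using (_×_; _,_; Σ; ∃; ∃-syntax)
open import Relation.Binary.PropositionalEquality using (_≡_; _≢_)

data Sign : Set where
  plus minus : Sign

neg : Sign → Sign
neg plus  = minus
neg minus = plus

bar : List Sign → List Sign
bar S = reverse (map neg S)

data Folding : ℕ → List Sign → Set where
  fold-zero : Folding zero []
  fold-suc  : ∀ {n S} (e : Sign) → Folding n S → Folding (suc n) (bar S ++ (e ∷ S))

Subword : List Sign → List Sign → Set
Subword w L = ∃[ u ] ∃[ v ] (L ≡ u ++ (w ++ v))

ZSeq : Set
ZSeq = ℤ → Sign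

window : ZSeq → ℤ → ℕ → List Sign
window b h zero    = []
window b h (suc m) = b (h + 1ℤ) ∷ window b (h + 1ℤ) m

CompleteFolding : ZSeq → Set
CompleteFolding a = ∀ (h : ℤ) (m : ℕ) → ∃[ n ] ∃[ S ] (Folding n S × Subword (window a h m) S)

LocallyIso : ZSeq → ZSeq → Set
LocallyIso a b =
  (∀ (h : ℤ) (m : ℕ) → ∃[ h' ] (window a h m ≡ window b h' m)) ×
  (∀ (h : ℤ) (m : ℕ) → ∃[ h' ] (window b h m ≡ window a h' m))

Point : Set
Point = ℤ × ℤ

data Dir : Set where
  east north west south : Dir

ccw : Dir → Dir
ccw east  = north
ccw north = west
ccw west  = south
ccw south = east

data Axis : Set where
  horiz vert : Axis

axis : Dir → Axis
axis east  = horiz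
axis west  = horiz
axis north = vert
axis south = vert

record Segment : Set where
  constructor seg
  field
    start : Point
    dir   : Dir
open Segment public

step : Point → Dir → Point
step (x , y) east  = (x + 1ℤ , y)
step (x , y) west  = (x - 1ℤ , y)
step (x , y) north = (x , y + 1ℤ)
step (x , y) south = (x , y - 1ℤ)

terminal : Segment → Point
terminal s = step (start s) (dir s)

-- unoriented unit edge: [(x,y),(x+1,y)] ↦ ((x,y), horiz); [(x,y),(x,y+1)] ↦ ((x,y), vert)
Edge : Set
Edge = Point × Axis

support : Segment → Edge
support (seg p east)  = (p , horiz)
support (seg p north) = (p , vert)
support (seg p west)  = (step p west , horiz)
support (seg p south) = (step p south , vert)

Curve : Set
Curve = ℤ → Segment

IsCompleteCurve : Curve → Set
IsCompleteCurve C =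
  (∀ i → terminal (C i) ≡ start (C (i + 1ℤ))) ×
  (∀ i → axis (dir (C i)) ≢ axis (dir (C (i + 1ℤ)))) ×
  (∀ i j → support (C i) ≡ support (C j) → i ≡ j)

-- turning sign from direction d to d' (+1 = left, −1 = right); used for perpendicular d, d'
turn : Dir → Dir → Sign
turn east  north = plus
turn north west  = plus
turn west  south = plus
turn south east  = plus
turn _     _     = minus

assocSeq : Curve → ZSeq
assocSeq C i = turn (dir (C i)) (dir (C (i + 1ℤ)))

IsCompleteFoldingCurve : Curve → Set
IsCompleteFoldingCurve C = IsCompleteCurve C × CompleteFolding (assocSeq C)

Covers : Curve → Set
Covers C = ∀ (e : Edge) → ∃[ i ] (support (C i) ≡ e × (∀ j → support (C j) ≡ e → j ≡ i))

{-# OPTIONS --safe #-}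
module Submission where

open import Defs
open import Algebra.Properties.AbelianGroup using (∙-cancelʳ)
open import Data.Empty using (⊥-elim)
open import Data.Integer using (ℤ; +_; -[1+_]; _+_; _-_; -_; 0ℤ; 1ℤ; ∣_∣)
import Data.Integer.Properties as ℤₚ
open import Data.Integer.Tactic.RingSolver using (solve-∀)
open import Data.List using (List; []; _∷_; _++_; reverse; map; length; cartesianProduct)
import Data.List.Membership.DecPropositional as DecMembership
open import Data.List.Membership.Propositional using (_∈_)
open import Data.List.Membership.Propositional.Properties using (∈-map⁺; ∈-cartesianProduct⁺)
import Data.List.Properties as Listₚ
open import Data.List.Relation.Binary.Subset.Propositional using (_⊆_)
open import Data.List.Relation.Unary.All as All using (All)
open import Data.List.Relation.Unary.Any using (here; there)
open import Data.Nat as ℕ using (ℕ; zero; suc; _≤_; _<_; z≤n; s≤s)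
open import Data.Nat.Induction using (<-wellFounded)
import Data.Nat.Properties as ℕₚ
open import Data.Product using (_×_; _,_; proj₁; proj₂; ∃; ∃-syntax)
open import Data.Product.Properties using (≡-dec)
open import Data.Sum using (_⊎_; inj₁; inj₂; [_,_]′)
open import Data.Unit using (⊤; tt)
open import Induction.WellFounded using (Acc; acc)
open import Relation.Binary.Definitions using (DecidableEquality)
open import Relation.Binary.PropositionalEquality
open import Relation.Nullary using (¬_)
open import Relation.Nullary.Decidable using (Dec; True; toWitness; map′)

-- A complete folding sequence alternates on one residue class mod 2, and the remaining terms form
-- again a complete folding sequence.  Iterating yields signs e₀ , e₁ , …, which determine the finite
-- subwords, hence the local isomorphism class, because every n-block word e n ± occurs.
--
-- Conversely, unfolding replaces each edge of a square lattice by two sides of the square having it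
-- as diagonal; every edge of the fine lattice arises exactly once in this way, and the only freedom
-- at each level is which of the two colour classes of fine points is the coarse lattice.
-- Passing to parents divides distances by √2, so every edge has an ancestor in a fixed finite set;
-- with lattice positions chosen suitably, depending on e, this set collapses to a single edge.
-- Any two edges of the plane then have a common ancestor, so they lie on one curve.

-- The positions of the lattices do not enter `e`, so they can be chosen without leaving the local
-- isomorphism class. With a bad choice the edges may fall into several curves, or the part
-- connected to a given edge may be infinite on one side only. The choice is therefore a game
-- against the signs, played without knowledge of later signs. One edge, `base`, is kept as its own
-- parent on all levels, so an edge lies on the curve of `base` as soon as some iterated parent of
-- it is `base`. The game is won on a finite set and replayed forever, since far edges need time to
-- enter this set. To be infinite in both directions, the curve needs `base` to be a first child on
-- infinitely many levels and a second child on infinitely many. Unfolding acts on the whole plane,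
-- not along a curve: a curve alternates between even and odd points, so alternation of the creases
-- means that an edge traversed from its even endpoint always turns by `e k`, and from its odd
-- endpoint by the opposite sign. The corner replacing an edge then depends on the edge alone.

infixr 7 _·_
_·_ : Sign → Sign → Sign
plus  · s = s
minus · s = neg s

neg-involutive : ∀ s → neg (neg s) ≡ s
neg-involutive plus  = refl
neg-involutive minus = refl

neg≢ : ∀ s → neg s ≢ s
neg≢ plus  ()
neg≢ minus ()

·-self : ∀ s t → s · s · t ≡ t
·-self plus  t = refl
·-self minus t = neg-involutive t

·-neg : ∀ s t → s · neg t ≡ neg (s · t)
·-neg plus  t = refl
·-neg minus t = refl

·-comm : ∀ s t → s · t ≡ t · s
·-comm plus  plus  = refl
·-comm plus  minus = refl
·-comm minus plus  = refl
·-comm minus minus = refl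

·-plus : ∀ s → s · plus ≡ s
·-plus plus  = refl
·-plus minus = refl

·-minus : ∀ s → s · minus ≡ neg s
·-minus plus  = refl
·-minus minus = refl

neg-· : ∀ s t → neg s · t ≡ neg (s · t)
neg-· plus  t = refl
neg-· minus t = sym (neg-involutive t)

·-conjugate : ∀ s t → (s · t) · s ≡ t
·-conjugate s t = trans (·-comm (s · t) s) (·-self s t)

-- Floor halving and binary digits of integers

bit : Sign → ℤ
bit plus  = 0ℤ
bit minus = 1ℤ

node : ℤ → Sign → ℤ
node i h = i + i + bit h

halveℕ : ℕ → ℕ × Sign
halveℕ zero          = 0 , plus
halveℕ (suc zero)    = 0 , minus
halveℕ (suc (suc n)) = let (q , h) = halveℕ n in suc q , h

-- `-[1+ n ]` is the bitwise complement of `n`: the quotient is complemented and the last digit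
-- flipped. This rounds downwards for both signs.
halve : ℤ → ℤ × Sign
halve (+ n)      = let (q , h) = halveℕ n in + q , h
halve (-[1+ n ]) = let (q , h) = halveℕ n in -[1+ q ] , neg h

half : ℤ → ℤ
half z = proj₁ (halve z)

parity : ℤ → Sign
parity z = proj₂ (halve z)

halveℕ-spec : ∀ n → + n ≡ node (+ proj₁ (halveℕ n)) (proj₂ (halveℕ n))
halveℕ-spec zero          = refl
halveℕ-spec (suc zero)    = refl
halveℕ-spec (suc (suc n)) = trans (cong (λ z → 1ℤ + 1ℤ + z) (halveℕ-spec n)) (shift (+ q) (bit h))
  where
  q = proj₁ (halveℕ n)
  h = proj₂ (halveℕ n)
  shift : ∀ a b → 1ℤ + 1ℤ + (a + a + b) ≡ (1ℤ + a) + (1ℤ + a) + b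
  shift = solve-∀

halve-spec : ∀ z → z ≡ node (half z) (parity z)
halve-spec (+ n)      = halveℕ-spec n
halve-spec (-[1+ n ]) = begin
  - (1ℤ + (+ n))                           ≡⟨ cong (λ z → - (1ℤ + z)) (halveℕ-spec n) ⟩
  - (1ℤ + node (+ q) h)                    ≡⟨ reflect (+ q) h ⟩
  node (- (1ℤ + (+ q))) (neg h)            ∎
  where
  open ≡-Reasoning
  q = proj₁ (halveℕ n)
  h = proj₂ (halveℕ n)
  reflect : ∀ a s → - (1ℤ + (a + a + bit s)) ≡ - (1ℤ + a) + - (1ℤ + a) + bit (neg s)
  reflect a plus = lem a
    where
    lem : ∀ a → - (1ℤ + (a + a + 0ℤ)) ≡ - (1ℤ + a) + - (1ℤ + a) + 1ℤ
    lem = solve-∀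
  reflect a minus = lem a
    where
    lem : ∀ a → - (1ℤ + (a + a + 1ℤ)) ≡ - (1ℤ + a) + - (1ℤ + a) + 0ℤ
    lem = solve-∀

double≢1 : ∀ k → k + k ≢ 1ℤ
double≢1 (+ zero)        ()
double≢1 (+ (suc zero))    ()
double≢1 (+ (suc (suc n))) ()
double≢1 -[1+ n ]        ()

double≡0 : ∀ k → k + k ≡ 0ℤ → k ≡ 0ℤ
double≡0 (+ zero)    _  = refl
double≡0 (+ (suc n)) ()
double≡0 -[1+ n ]    ()

node-injective : ∀ i j g h → node i g ≡ node j h → i ≡ j × g ≡ h
node-injective i j plus plus eq = ℤₚ.i-j≡0⇒i≡j i j (double≡0 (i - j) (trans (lem i j) (ℤₚ.i≡j⇒i-j≡0 eq))) , refl
  where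
  lem : ∀ i j → (i - j) + (i - j) ≡ (i + i + 0ℤ) - (j + j + 0ℤ)
  lem = solve-∀
node-injective i j minus minus eq = ℤₚ.i-j≡0⇒i≡j i j (double≡0 (i - j) (trans (lem i j) (ℤₚ.i≡j⇒i-j≡0 eq))) , refl
  where
  lem : ∀ i j → (i - j) + (i - j) ≡ (i + i + 1ℤ) - (j + j + 1ℤ)
  lem = solve-∀
node-injective i j plus minus eq = ⊥-elim (double≢1 (i - j) (trans (lem i j) (cong (_+ 1ℤ) (ℤₚ.i≡j⇒i-j≡0 eq))))
  where
  lem : ∀ i j → (i - j) + (i - j) ≡ (i + i + 0ℤ) - (j + j + 1ℤ) + 1ℤ
  lem = solve-∀
node-injective i j minus plus eq = ⊥-elim (double≢1 (j - i) (trans (lem i j) (cong (_+ 1ℤ) (ℤₚ.i≡j⇒i-j≡0 (sym eq)))))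
  where
  lem : ∀ i j → (j - i) + (j - i) ≡ (j + j + 0ℤ) - (i + i + 1ℤ) + 1ℤ
  lem = solve-∀

halve-node : ∀ i h → halve (node i h) ≡ (i , h)
halve-node i h with node-injective (half (node i h)) i (parity (node i h)) h (sym (halve-spec (node i h)))
... | p , q = cong₂ _,_ p q

ℤ-induction : ∀ {ℓ} (P : ℤ → Set ℓ) → P 0ℤ → (∀ i → P i → P (i + 1ℤ)) → (∀ i → P i → P (i - 1ℤ)) → ∀ i → P i
ℤ-induction P p up down (+ zero)     = p
ℤ-induction P p up down (+ (suc n))  = subst P (ℤₚ.+-comm (+ n) 1ℤ) (up (+ n) (ℤ-induction P p up down (+ n)))
ℤ-induction P p up down -[1+ zero ]  = down 0ℤ p
ℤ-induction P p up down -[1+ suc n ] = subst P (cong (λ k → -[1+ suc k ]) (ℕₚ.+-identityʳ n)) (down -[1+ n ] (ℤ-induction P p up down -[1+ n ]))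

-- Folding words and towers

-- `bar` exchanges the two words of a level (`bar-word`), so the halves of a block are always the
-- `plus` word followed by the `minus` word, and `h` shows only in the middle sign.
word : (ℕ → Sign) → ℕ → Sign → List Sign
word e zero    h = []
word e (suc n) h = word e n plus ++ (e n · h) ∷ word e n minus

bar-++-∷ : ∀ xs y ys → bar (xs ++ y ∷ ys) ≡ bar ys ++ neg y ∷ bar xs
bar-++-∷ xs y ys = begin
  reverse (map neg (xs ++ y ∷ ys))                        ≡⟨ cong reverse (Listₚ.map-++ neg xs (y ∷ ys)) ⟩
  reverse (map neg xs ++ neg y ∷ map neg ys)              ≡⟨ Listₚ.reverse-++ (map neg xs) (neg y ∷ map neg ys) ⟩
  reverse (neg y ∷ map neg ys) ++ bar xs                  ≡⟨ cong (_++ bar xs) (Listₚ.unfold-reverse (neg y) (map neg ys)) ⟩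
  (bar ys ++ neg y ∷ []) ++ bar xs                        ≡⟨ Listₚ.++-assoc (bar ys) (neg y ∷ []) (bar xs) ⟩
  bar ys ++ neg y ∷ bar xs                                ∎
  where open ≡-Reasoning

bar-word : ∀ e n h → bar (word e n h) ≡ word e n (neg h)
bar-word e zero    h = refl
bar-word e (suc n) h = begin
  bar (word e n plus ++ (e n · h) ∷ word e n minus)           ≡⟨ bar-++-∷ (word e n plus) (e n · h) (word e n minus) ⟩
  bar (word e n minus) ++ neg (e n · h) ∷ bar (word e n plus) ≡⟨ cong₂ (λ u v → u ++ neg (e n · h) ∷ v) (bar-word e n minus) (bar-word e n plus) ⟩
  word e n plus ++ neg (e n · h) ∷ word e n minus             ≡⟨ cong (λ s → word e n plus ++ s ∷ word e n minus) (sym (·-neg (e n) h)) ⟩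
  word e (suc n) (neg h)                                      ∎
  where open ≡-Reasoning

word-Folding : ∀ e n h → Folding n (word e n h)
word-Folding e zero    h = fold-zero
word-Folding e (suc n) h = subst (λ u → Folding (suc n) (u ++ (e n · h) ∷ word e n minus))
                                 (bar-word e n minus) (fold-suc (e n · h) (word-Folding e n minus))

Subword-trans : ∀ {u v w} → Subword u v → Subword v w → Subword u w
Subword-trans {u} (a , b , refl) (c , d , refl) = c ++ a , b ++ d , (begin
  c ++ (a ++ u ++ b) ++ d   ≡⟨ cong (c ++_) (Listₚ.++-assoc a (u ++ b) d) ⟩
  c ++ a ++ (u ++ b) ++ d   ≡⟨ cong (λ l → c ++ a ++ l) (Listₚ.++-assoc u b d) ⟩
  c ++ a ++ u ++ b ++ d     ≡⟨ sym (Listₚ.++-assoc c a (u ++ b ++ d)) ⟩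
  (c ++ a) ++ u ++ b ++ d   ∎)
  where open ≡-Reasoning

-- For h = plus the junction is an (n + 1)-block; for h = minus it is the middle of an (n + 2)-block.
junction-Subword : ∀ e n h t → ∃[ g ] Subword (word e n h ++ t ∷ word e n (neg h)) (word e (suc (suc n)) g)
junction-Subword e n plus t with e n · t in eq
... | plus = plus , [] , _ , cong (λ s → (word e n plus ++ s ∷ word e n minus) ++ (e (suc n) · plus) ∷ word e (suc n) minus)
                              (trans (sym (cong (e n ·_) eq)) (·-self (e n) t))
... | minus = plus , word e (suc n) plus ++ (e (suc n) · plus) ∷ [] , [] , (begin
  word e (suc n) plus ++ s ∷ word e n plus ++ (e n · minus) ∷ word e n minus
    ≡⟨ cong (λ r → word e (suc n) plus ++ s ∷ word e n plus ++ r ∷ word e n minus) (trans (sym (cong (e n ·_) eq)) (·-self (e n) t)) ⟩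
  word e (suc n) plus ++ s ∷ word e n plus ++ t ∷ word e n minus
    ≡⟨ sym (Listₚ.++-assoc (word e (suc n) plus) (s ∷ []) _) ⟩
  (word e (suc n) plus ++ s ∷ []) ++ word e n plus ++ t ∷ word e n minus
    ≡⟨ cong ((word e (suc n) plus ++ s ∷ []) ++_) (sym (Listₚ.++-identityʳ _)) ⟩
  (word e (suc n) plus ++ s ∷ []) ++ (word e n plus ++ t ∷ word e n minus) ++ [] ∎)
  where
  open ≡-Reasoning
  s = e (suc n) · plus
junction-Subword e n minus t = e (suc n) · t , word e n plus ++ (e n · plus) ∷ [] , (e n · minus) ∷ word e n minus , (begin
  (u ++ p ∷ v) ++ (e (suc n) · e (suc n) · t) ∷ u ++ q ∷ v
    ≡⟨ cong (λ s → (u ++ p ∷ v) ++ s ∷ u ++ q ∷ v) (·-self (e (suc n)) t) ⟩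
  (u ++ p ∷ v) ++ t ∷ u ++ q ∷ v
    ≡⟨ Listₚ.++-assoc u (p ∷ v) _ ⟩
  u ++ p ∷ v ++ t ∷ u ++ q ∷ v
    ≡⟨ sym (Listₚ.++-assoc u (p ∷ []) _) ⟩
  (u ++ p ∷ []) ++ v ++ t ∷ u ++ q ∷ v
    ≡⟨ cong ((u ++ p ∷ []) ++_) (sym (Listₚ.++-assoc v (t ∷ u) (q ∷ v))) ⟩
  (u ++ p ∷ []) ++ (v ++ t ∷ u) ++ q ∷ v ∎)
  where
  open ≡-Reasoning
  u = word e n plus
  v = word e n minus
  p = e n · plus
  q = e n · minus

-- Windows of a sequence

win : ZSeq → ℤ → ℕ → List Sign
win X i zero    = []
win X i (suc m) = X i ∷ win X (i + 1ℤ) m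

window≡win : ∀ X h m → window X h m ≡ win X (h + 1ℤ) m
window≡win X h zero    = refl
window≡win X h (suc m) = cong (X (h + 1ℤ) ∷_) (window≡win X (h + 1ℤ) m)

win≡window : ∀ X i m → win X i m ≡ window X (i - 1ℤ) m
win≡window X i m = trans (cong (λ j → win X j m) (lem i)) (sym (window≡win X (i - 1ℤ) m))
  where
  lem : ∀ i → i ≡ i - 1ℤ + 1ℤ
  lem = solve-∀

length-win : ∀ X i m → length (win X i m) ≡ m
length-win X i zero    = refl
length-win X i (suc m) = cong suc (length-win X (i + 1ℤ) m)

win-+ : ∀ X i m n → win X i (m ℕ.+ n) ≡ win X i m ++ win X (i + + m) n
win-+ X i zero    n = cong (λ j → win X j n) (sym (ℤₚ.+-identityʳ i))
win-+ X i (suc m) n = cong (X i ∷_) (trans (win-+ X (i + 1ℤ) m n)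
  (cong (λ j → win X (i + 1ℤ) m ++ win X j n) (ℤₚ.+-assoc i 1ℤ (+ m))))

++-cancel-length : ∀ (u u' v v' : List Sign) → length u ≡ length u' → u ++ v ≡ u' ++ v' → u ≡ u' × v ≡ v'
++-cancel-length []      []        v v' _  eq = refl , eq
++-cancel-length (x ∷ u) (x' ∷ u') v v' le eq with Listₚ.∷-injective eq
... | refl , eq' with ++-cancel-length u u' v v' (ℕₚ.suc-injective le) eq'
... | refl , eq'' = refl , eq''

Subword-win : ∀ X i n w → Subword w (win X i n) → ∃[ j ] w ≡ win X j (length w)
Subword-win X i n w (u , v , eq) = i + + length u , sym (proj₁ (++-cancel-length _ w (win X (i + + length u + + length w) (length v)) v (length-win X _ (length w))
    (proj₂ (++-cancel-length (win X i (length u)) u _ (w ++ v) (length-win X i (length u)) split))))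
  where
  open ≡-Reasoning
  size : length u ℕ.+ (length w ℕ.+ length v) ≡ n
  size = begin
    length u ℕ.+ (length w ℕ.+ length v) ≡⟨ cong (length u ℕ.+_) (sym (Listₚ.length-++ w)) ⟩
    length u ℕ.+ length (w ++ v)         ≡⟨ sym (Listₚ.length-++ u) ⟩
    length (u ++ w ++ v)                 ≡⟨ cong length (sym eq) ⟩
    length (win X i n)                   ≡⟨ length-win X i n ⟩
    n                                    ∎
  split : win X i (length u) ++ win X (i + + length u) (length w) ++ win X (i + + length u + + length w) (length v) ≡ u ++ w ++ v
  split = begin
    win X i (length u) ++ win X (i + + length u) (length w) ++ win X (i + + length u + + length w) (length v)
      ≡⟨ cong (win X i (length u) ++_) (sym (win-+ X (i + + length u) (length w) (length v))) ⟩
    win X i (length u) ++ win X (i + + length u) (length w ℕ.+ length v)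
      ≡⟨ sym (win-+ X i (length u) (length w ℕ.+ length v)) ⟩
    win X i (length u ℕ.+ (length w ℕ.+ length v))
      ≡⟨ cong (win X i) size ⟩
    win X i n
      ≡⟨ eq ⟩
    u ++ w ++ v ∎

Subword-subwin : ∀ X i a m b → Subword (win X (i + + a) m) (win X i (a ℕ.+ (m ℕ.+ b)))
Subword-subwin X i a m b = win X i a , win X (i + + a + + m) b ,
  trans (win-+ X i a (m ℕ.+ b)) (cong (win X i a ++_) (win-+ X (i + + a) m b))

-- Level k + 1 is level k without its creases, the alternating terms at the positions i + i + off k.
-- The sign of a crease is fixed by whether i is itself the position of a crease of level k + 1 (h = plus),
-- which makes e independent of the choice of the origin.
record Tower (e : ℕ → Sign) (X : ZSeq) : Set where
  field
    level  : ℕ → ZSeq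
    off    : ℕ → ℤ
    bottom : ∀ i → level 0 i ≡ X i
    crease : ∀ k j h → let i = node j h + off (suc k) in level k (i + i + off k) ≡ e k · h
    lift   : ∀ k i → level k (i + i + off k + 1ℤ) ≡ level (suc k) i

blockLength : ℕ → ℕ
blockLength zero    = 0
blockLength (suc n) = blockLength n ℕ.+ suc (blockLength n)

n≤blockLength : ∀ n → n ≤ blockLength n
n≤blockLength zero    = z≤n
n≤blockLength (suc n) = ℕₚ.≤-trans (s≤s (n≤blockLength n)) (ℕₚ.m≤n+m (suc (blockLength n)) (blockLength n))

module TowerProperties {e : ℕ → Sign} {X : ZSeq} (T : Tower e X) where
  open Tower T

  -- The place in `X` where block number `i` of level `n` starts; the block is followed by one
  -- separating term, which is `level n i`.
  pos : ℕ → ℤ → ℤ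
  pos zero    i = i
  pos (suc n) i = pos n (i + i + off n)

  pos-suc : ∀ n i → pos n (i + 1ℤ) ≡ pos n i + + suc (blockLength n)
  pos-suc zero    i = refl
  pos-suc (suc n) i = begin
    pos n (i + 1ℤ + (i + 1ℤ) + off n)          ≡⟨ cong (pos n) (lem i (off n)) ⟩
    pos n (i + i + off n + 1ℤ + 1ℤ)            ≡⟨ pos-suc n (i + i + off n + 1ℤ) ⟩
    pos n (i + i + off n + 1ℤ) + + L           ≡⟨ cong (_+ + L) (pos-suc n (i + i + off n)) ⟩
    pos n (i + i + off n) + + L + + L          ≡⟨ ℤₚ.+-assoc (pos n (i + i + off n)) (+ L) (+ L) ⟩
    pos n (i + i + off n) + + (L ℕ.+ L)        ∎
    where
    open ≡-Reasoning
    L = suc (blockLength n)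
    lem : ∀ i o → i + 1ℤ + (i + 1ℤ) + o ≡ i + i + o + 1ℤ + 1ℤ
    lem = solve-∀

  separator : ∀ n i → X (pos n i + + blockLength n) ≡ level n i
  separator zero    i = trans (cong X (ℤₚ.+-identityʳ i)) (sym (bottom i))
  separator (suc n) i = begin
    X (pos n j + + (L ℕ.+ suc L))      ≡⟨ cong (λ m → X (pos n j + + m)) (ℕₚ.+-comm L (suc L)) ⟩
    X (pos n j + (+ suc L + + L))      ≡⟨ cong X (sym (ℤₚ.+-assoc (pos n j) (+ suc L) (+ L))) ⟩
    X (pos n j + + suc L + + L)        ≡⟨ cong (λ z → X (z + + L)) (sym (pos-suc n j)) ⟩
    X (pos n (j + 1ℤ) + + L)           ≡⟨ separator n (j + 1ℤ) ⟩
    level n (j + 1ℤ)                   ≡⟨ lift n i ⟩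
    level (suc n) i                    ∎
    where
    open ≡-Reasoning
    L = blockLength n
    j = i + i + off n

  blocks : ∀ n i → win X (pos n i) (blockLength n ℕ.+ suc (blockLength n))
                 ≡ win X (pos n i) (blockLength n) ++ level n i ∷ win X (pos n (i + 1ℤ)) (blockLength n)
  blocks n i = begin
    win X p (L ℕ.+ suc L)                                          ≡⟨ win-+ X p L (suc L) ⟩
    win X p L ++ X (p + + L) ∷ win X (p + + L + 1ℤ) L              ≡⟨ cong₂ (λ s q → win X p L ++ s ∷ win X q L) (separator n i) next ⟩
    win X p L ++ level n i ∷ win X (pos n (i + 1ℤ)) L              ∎
    where
    open ≡-Reasoning
    L = blockLength n
    p = pos n i
    next : p + + L + 1ℤ ≡ pos n (i + 1ℤ)
    next = trans (ℤₚ.+-assoc p (+ L) 1ℤ) (trans (cong (λ m → p + + m) (ℕₚ.+-comm L 1)) (sym (pos-suc n i)))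

  -- The halves of block `i` of level `n + 1` are the blocks `i + i + off n` and its successor, to
  -- which the induction hypothesis applies with `plus` and `minus`; the middle sign is given by
  -- `crease`.
  block : ∀ n j h → win X (pos n (node j h + off n)) (blockLength n) ≡ word e n h
  block zero    j h = refl
  block (suc n) j h = begin
    win X (pos n (i + i + off n)) (L ℕ.+ suc L)
      ≡⟨ blocks n (i + i + off n) ⟩
    win X (pos n (i + i + off n)) L ++ level n (i + i + off n) ∷ win X (pos n (i + i + off n + 1ℤ)) L
      ≡⟨ cong₂ (λ u v → u ++ level n (i + i + off n) ∷ v)
           (trans (cong (λ z → win X (pos n z) L) (lem₀ i (off n))) (block n i plus))
           (trans (cong (λ z → win X (pos n z) L) (lem₁ i (off n))) (block n i minus)) ⟩
    word e n plus ++ level n (i + i + off n) ∷ word e n minus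
      ≡⟨ cong (λ s → word e n plus ++ s ∷ word e n minus) (crease n j h) ⟩
    word e (suc n) h ∎
    where
    open ≡-Reasoning
    L = blockLength n
    i = node j h + off (suc n)
    lem₀ : ∀ i o → i + i + o ≡ i + i + 0ℤ + o
    lem₀ = solve-∀
    lem₁ : ∀ i o → i + i + o + 1ℤ ≡ i + i + 1ℤ + o
    lem₁ = solve-∀

  split-off : ∀ n i → i ≡ node (half (i - off n)) (parity (i - off n)) + off n
  split-off n i = trans (lem i (off n)) (cong (_+ off n) (halve-spec (i - off n)))
    where
    lem : ∀ i o → i ≡ i - o + o
    lem = solve-∀

  -- The bound is not strict: `r ≡ blockLength n` is the separator behind the block.
  locate : ∀ n z → ∃[ i ] ∃[ r ] (z ≡ pos n i + + r × r ≤ blockLength n)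
  locate zero    z = z , 0 , sym (ℤₚ.+-identityʳ z) , z≤n
  locate (suc n) z with locate n z
  ... | i , r , refl , r≤L with half (i - off n) | parity (i - off n) | split-off n i
  ... | j | plus  | refl = j , r , cong (λ k → pos n k + + r) (lem j (off n)) , ℕₚ.≤-trans r≤L (ℕₚ.m≤m+n _ _)
    where
    lem : ∀ j o → j + j + 0ℤ + o ≡ j + j + o
    lem = solve-∀
  ... | j | minus | refl = j , suc (blockLength n) ℕ.+ r , (begin
      pos n (j + j + 1ℤ + off n) + + r                        ≡⟨ cong (λ k → pos n k + + r) (lem j (off n)) ⟩
      pos n (j + j + off n + 1ℤ) + + r                        ≡⟨ cong (_+ + r) (pos-suc n (j + j + off n)) ⟩
      pos n (j + j + off n) + + suc (blockLength n) + + r     ≡⟨ ℤₚ.+-assoc (pos n (j + j + off n)) (+ suc (blockLength n)) (+ r) ⟩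
      pos n (j + j + off n) + + (suc (blockLength n) ℕ.+ r)   ∎)
    , ℕₚ.≤-trans (ℕₚ.+-monoʳ-≤ (suc (blockLength n)) r≤L) (ℕₚ.≤-reflexive (ℕₚ.+-comm (suc (blockLength n)) (blockLength n)))
    where
    open ≡-Reasoning
    lem : ∀ j o → j + j + 1ℤ + o ≡ j + j + o + 1ℤ
    lem = solve-∀

  junction : ∀ n i → ∃[ h ] win X (pos n i) (blockLength n ℕ.+ suc (blockLength n)) ≡ word e n h ++ level n i ∷ word e n (neg h)
  junction n i with half (i - off n) | parity (i - off n) | split-off n i
  ... | j | plus  | refl = plus , trans (blocks n _) (cong₂ (λ u v → u ++ level n _ ∷ v) (block n j plus)
          (trans (cong (λ z → win X (pos n z) (blockLength n)) (lem j (off n))) (block n j minus)))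
    where
    lem : ∀ j o → j + j + 0ℤ + o + 1ℤ ≡ j + j + 1ℤ + o
    lem = solve-∀
  ... | j | minus | refl = minus , trans (blocks n _) (cong₂ (λ u v → u ++ level n _ ∷ v) (block n j minus)
          (trans (cong (λ z → win X (pos n z) (blockLength n)) (lem j (off n))) (block n (j + 1ℤ) plus)))
    where
    lem : ∀ j o → j + j + 1ℤ + o + 1ℤ ≡ j + 1ℤ + (j + 1ℤ) + 0ℤ + o
    lem = solve-∀

  -- Blocks of level `m` are long enough: since `m ≤ blockLength m`, a window of length `m` that
  -- starts in a block or on its separator ends within the next block.
  win⊆word : ∀ z m → ∃[ n ] ∃[ h ] Subword (win X z m) (word e n h)
  win⊆word z m with locate m z
  ... | i , r , refl , r≤L with junction m i
  ... | h , eq with junction-Subword e m h (level m i)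
  ... | g , sub = suc (suc m) , g , Subword-trans (subst (Subword _) (trans (cong (win X (pos m i)) size) eq) (Subword-subwin X (pos m i) r m _)) sub
    where
    fits : r ℕ.+ m ≤ blockLength m ℕ.+ suc (blockLength m)
    fits = ℕₚ.+-mono-≤ r≤L (ℕₚ.m≤n⇒m≤1+n (n≤blockLength m))
    size : r ℕ.+ (m ℕ.+ (blockLength m ℕ.+ suc (blockLength m) ℕ.∸ (r ℕ.+ m))) ≡ blockLength m ℕ.+ suc (blockLength m)
    size = trans (sym (ℕₚ.+-assoc r m _)) (ℕₚ.m+[n∸m]≡n fits)

  word⊆ : ∀ n h → ∃[ z ] win X z (blockLength n) ≡ word e n h
  word⊆ n h = _ , block n 0ℤ h

  completeFolding : CompleteFolding X
  completeFolding z m with win⊆word (z + 1ℤ) m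
  ... | n , h , sub = n , word e n h , word-Folding e n h , subst (λ w → Subword w (word e n h)) (sym (window≡win X z m)) sub

-- A window of `X` lies in some word of `e`, and every word of `e` occurs in `Y`, whatever the
-- offsets of the two towers.
window-transfer : ∀ {e X Y} → Tower e X → Tower e Y → ∀ z m → ∃[ z' ] window X z m ≡ window Y z' m
window-transfer {e} {X} {Y} TX TY z m with TowerProperties.win⊆word TX (z + 1ℤ) m
... | n , h , sub with TowerProperties.word⊆ TY n h
... | p , eq with Subword-win Y p (blockLength n) (win X (z + 1ℤ) m) (subst (Subword _) (sym eq) sub)
... | j , eq' = j - 1ℤ , (begin
  window X z m                              ≡⟨ window≡win X z m ⟩
  win X (z + 1ℤ) m                          ≡⟨ eq' ⟩
  win Y j (length (win X (z + 1ℤ) m))       ≡⟨ cong (win Y j) (length-win X (z + 1ℤ) m) ⟩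
  win Y j m                                 ≡⟨ win≡window Y j m ⟩
  window Y (j - 1ℤ) m                       ∎)
  where open ≡-Reasoning

tower-LocallyIso : ∀ {e X Y} → Tower e X → Tower e Y → LocallyIso X Y
tower-LocallyIso TX TY = window-transfer TX TY , window-transfer TY TX

-- Decoding a complete folding sequence

unfold : Sign → List Sign → List Sign
unfold s []       = s ∷ []
unfold s (x ∷ xs) = s ∷ x ∷ unfold (neg s) xs

-- The last crease of `unfold s xs`.
phase : Sign → List Sign → Sign
phase s []       = s
phase s (x ∷ xs) = phase (neg s) xs

phase-neg : ∀ s xs → phase (neg s) xs ≡ neg (phase s xs)
phase-neg s []       = refl
phase-neg s (x ∷ xs) = phase-neg (neg s) xs

phase-++-∷ : ∀ s xs y ys → phase s (xs ++ y ∷ ys) ≡ phase (neg (phase s xs)) ys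
phase-++-∷ s []       y ys = refl
phase-++-∷ s (x ∷ xs) y ys = phase-++-∷ (neg s) xs y ys

bar-∷ : ∀ x xs → bar (x ∷ xs) ≡ bar xs ++ neg x ∷ []
bar-∷ x xs = bar-++-∷ [] x xs

phase-bar : ∀ s xs → phase s (bar xs) ≡ phase s xs
phase-bar s []       = refl
phase-bar s (x ∷ xs) = begin
  phase s (bar (x ∷ xs))           ≡⟨ cong (phase s) (bar-∷ x xs) ⟩
  phase s (bar xs ++ neg x ∷ [])   ≡⟨ phase-++-∷ s (bar xs) (neg x) [] ⟩
  neg (phase s (bar xs))           ≡⟨ cong neg (phase-bar s xs) ⟩
  neg (phase s xs)                 ≡⟨ sym (phase-neg s xs) ⟩
  phase (neg s) xs                 ∎
  where open ≡-Reasoning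

phase-phase : ∀ s xs → phase (phase s xs) xs ≡ s
phase-phase s []       = refl
phase-phase s (x ∷ xs) = begin
  phase (neg (phase (neg s) xs)) xs  ≡⟨ phase-neg (phase (neg s) xs) xs ⟩
  neg (phase (phase (neg s) xs) xs)  ≡⟨ cong neg (phase-phase (neg s) xs) ⟩
  neg (neg s)                        ≡⟨ neg-involutive s ⟩
  s                                  ∎
  where open ≡-Reasoning

unfold-++-∷ : ∀ s xs y ys → unfold s (xs ++ y ∷ ys) ≡ unfold s xs ++ y ∷ unfold (neg (phase s xs)) ys
unfold-++-∷ s []       y ys = refl
unfold-++-∷ s (x ∷ xs) y ys = cong (λ l → s ∷ x ∷ l) (unfold-++-∷ (neg s) xs y ys)

-- `bar` moves the last crease to the front and changes its sign. Continued across the middle term,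
-- the alternation arrives at the second half with exactly its first crease `s`.
phase-return : ∀ s xs → neg (phase (neg (phase s xs)) (bar xs)) ≡ s
phase-return s xs = begin
  neg (phase (neg (phase s xs)) (bar xs))  ≡⟨ cong neg (phase-bar _ xs) ⟩
  neg (phase (neg (phase s xs)) xs)        ≡⟨ cong neg (phase-neg (phase s xs) xs) ⟩
  neg (neg (phase (phase s xs) xs))        ≡⟨ neg-involutive _ ⟩
  phase (phase s xs) xs                    ≡⟨ phase-phase s xs ⟩
  s                                        ∎
  where open ≡-Reasoning

bar-unfold : ∀ s xs → bar (unfold s xs) ≡ unfold (neg (phase s xs)) (bar xs)
bar-unfold s []       = refl
bar-unfold s (x ∷ xs) = begin
  bar (s ∷ x ∷ unfold (neg s) xs)
    ≡⟨ bar-++-∷ (s ∷ []) x (unfold (neg s) xs) ⟩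
  bar (unfold (neg s) xs) ++ neg x ∷ neg s ∷ []
    ≡⟨ cong₂ (λ l t → l ++ neg x ∷ t ∷ []) (bar-unfold (neg s) xs) (sym (phase-return (neg s) xs)) ⟩
  unfold t (bar xs) ++ neg x ∷ neg (phase t (bar xs)) ∷ []
    ≡⟨ sym (unfold-++-∷ t (bar xs) (neg x) []) ⟩
  unfold t (bar xs ++ neg x ∷ [])
    ≡⟨ cong (unfold t) (sym (bar-∷ x xs)) ⟩
  unfold t (bar (x ∷ xs)) ∎
  where
  open ≡-Reasoning
  t = neg (phase (neg s) xs)

-- The definition joins two halves at a middle term; this is the dual view, inserting creases around
-- the terms of a shorter fold. The two agree because the alternation passes through the middle
-- (`phase-return`).
Folding-unfold : ∀ {n S} → Folding (suc n) S → ∃[ s ] ∃[ R ] (S ≡ unfold s R × Folding n R)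
Folding-unfold {zero}  (fold-suc e fold-zero) = e , [] , refl , fold-zero
Folding-unfold {suc n} (fold-suc e F) with Folding-unfold F
... | s , R , refl , G = t , bar R ++ e ∷ R , (begin
  bar (unfold s R) ++ e ∷ unfold s R                               ≡⟨ cong₂ (λ l r → l ++ e ∷ unfold r R) (bar-unfold s R) (sym (phase-return s R)) ⟩
  unfold t (bar R) ++ e ∷ unfold (neg (phase t (bar R))) R         ≡⟨ sym (unfold-++-∷ t (bar R) e R) ⟩
  unfold t (bar R ++ e ∷ R)                                        ∎) , fold-suc e G
  where
  open ≡-Reasoning
  t = neg (phase s R)

tail-unfold : ∀ s R u x w → unfold s R ≡ u ++ x ∷ w →
  (∃[ t ] ∃[ p ] ∃[ Q ] (x ∷ w ≡ unfold t Q × R ≡ p ++ Q)) ⊎ (∃[ t ] ∃[ p ] ∃[ Q ] (w ≡ unfold t Q × R ≡ p ++ x ∷ Q))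
tail-unfold s R        []          x w eq = inj₁ (s , [] , R , sym eq , refl)
tail-unfold s []       (a ∷ [])    x w ()
tail-unfold s []       (a ∷ b ∷ u) x w ()
tail-unfold s (y ∷ R)  (a ∷ [])    x w eq with Listₚ.∷-injective (proj₂ (Listₚ.∷-injective eq))
... | refl , eq' = inj₂ (neg s , [] , R , sym eq' , refl)
tail-unfold s (y ∷ R)  (a ∷ b ∷ u) x w eq with tail-unfold (neg s) R u x w (proj₂ (Listₚ.∷-injective (proj₂ (Listₚ.∷-injective eq))))
... | inj₁ (t , p , Q , eq₁ , eq₂) = inj₁ (t , y ∷ p , Q , eq₁ , cong (y ∷_) eq₂)
... | inj₂ (t , p , Q , eq₁ , eq₂) = inj₂ (t , y ∷ p , Q , eq₁ , cong (y ∷_) eq₂)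

unfold-crease≢ : ∀ s R x b v → unfold s R ≢ x ∷ b ∷ x ∷ v
unfold-crease≢ s (_ ∷ [])    x b v eq with Listₚ.∷-injective eq
... | refl , eq' = neg≢ s (Listₚ.∷-injectiveˡ (Listₚ.∷-injectiveʳ eq'))
unfold-crease≢ s (_ ∷ _ ∷ _) x b v eq with Listₚ.∷-injective eq
... | refl , eq' = neg≢ s (Listₚ.∷-injectiveˡ (Listₚ.∷-injectiveʳ eq'))

-- Among four consecutive terms, either the first and third or the second and fourth are successive
-- creases, hence opposite.
no-alternating-Subword : ∀ b {n S} → Folding n S → ¬ Subword (b ∷ neg b ∷ b ∷ neg b ∷ []) S
no-alternating-Subword b {zero}  fold-zero ([]    , v , ())
no-alternating-Subword b {zero}  fold-zero (_ ∷ _ , v , ())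
no-alternating-Subword b {suc n} F (u , v , eq) with Folding-unfold F
... | s , R , refl , _ with tail-unfold s R u b _ eq
... | inj₁ (t , _ , Q , eq' , _) = unfold-crease≢ t Q _ _ _ (sym eq')
... | inj₂ (t , _ , Q , eq' , _) = unfold-crease≢ t Q _ _ _ (sym eq')

double : ℕ → ℕ
double zero    = zero
double (suc n) = suc (suc (double n))

Alternates : ZSeq → Sign → ℤ → ℕ → Set
Alternates X s i zero    = ⊤
Alternates X s i (suc n) = X i ≡ s × Alternates X (neg s) (i + 1ℤ + 1ℤ) n

between : ZSeq → ℤ → ℕ → List Sign
between X i zero    = []
between X i (suc n) = X (i + 1ℤ) ∷ between X (i + 1ℤ + 1ℤ) n

win-unfold : ∀ X i n v s R → win X i (double n) ++ v ≡ unfold s R →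
  Alternates X s i n × ∃[ v' ] R ≡ between X i n ++ v'
win-unfold X i zero    v s R       eq = tt , R , refl
win-unfold X i (suc n) v s []      eq with Listₚ.∷-injective eq
... | _ , ()
win-unfold X i (suc n) v s (y ∷ R) eq with Listₚ.∷-injective eq
... | eq₀ , eq' with Listₚ.∷-injective eq'
... | refl , eq'' with win-unfold X (i + 1ℤ + 1ℤ) n v (neg s) R eq''
... | alt , v' , refl = (eq₀ , alt) , v' , refl

-- A finite approximation to "the positions `i`, `i + 2`, ... carry the creases", since only finite
-- windows are known to come from folds.
Creased : ZSeq → ℤ → ℕ → Set
Creased X i n = (∃[ s ] Alternates X s i n) × ∃[ k ] ∃[ S ] (Folding k S × Subword (between X i n) S)

creased-either : ∀ X → CompleteFolding X → ∀ i n → Creased X i n ⊎ Creased X (i + 1ℤ) n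
creased-either X CF i n with CF (i - 1ℤ) (suc (double n))
... | k , S , F , sub with subst (λ w → Subword w S) (sym (win≡window X i (suc (double n)))) sub
creased-either X CF i n | zero  , _ , fold-zero , _ | []    , _ , ()
creased-either X CF i n | zero  , _ , fold-zero , _ | _ ∷ _ , _ , ()
creased-either X CF i n | suc k , S , F , _ | u , v , eq with Folding-unfold F
... | s , R , refl , G with tail-unfold s R u (X i) (win X (i + 1ℤ) (double n) ++ v) eq
... | inj₂ (t , p , Q , eq₁ , refl) with win-unfold X (i + 1ℤ) n v t Q eq₁
... | alt , v' , refl = inj₂ ((t , alt) , k , R , G , p ++ X i ∷ [] , v' , sym (Listₚ.++-assoc p (X i ∷ []) _))
creased-either X CF i n | suc k , S , F , _ | u , v , eq | s , R , refl , G | inj₁ (t , p , Q , eq₁ , refl)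
  with win-unfold X i n (win X (i + + double n) 1 ++ v) t Q (trans resplit eq₁)
  where
  resplit : win X i (double n) ++ win X (i + + double n) 1 ++ v ≡ win X i (suc (double n)) ++ v
  resplit = trans (sym (Listₚ.++-assoc (win X i (double n)) _ v))
    (cong (_++ v) (trans (sym (win-+ X i (double n) 1)) (cong (win X i) (ℕₚ.+-comm (double n) 1))))
... | alt , v' , refl = inj₁ ((t , alt) , k , R , G , p , v' , refl)

creased-next : ∀ X i n → Creased X i (suc n) → Creased X (i + 1ℤ + 1ℤ) n
creased-next X i n ((s , _ , alt) , k , S , F , u , v , eq) =
  (neg s , alt) , k , S , F , u ++ X (i + 1ℤ) ∷ [] , v , trans eq (sym (Listₚ.++-assoc u (X (i + 1ℤ) ∷ []) _))

creased-shrink : ∀ X m n i → Creased X i (n ℕ.+ m) → Creased X i n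
creased-shrink X m n i ((s , alt) , k , S , F , u , v , eq) =
  (s , shrink-alt n i s alt) , k , S , F , u , proj₁ (shrink n i) ++ v ,
  trans eq (cong (u ++_) (trans (cong (_++ v) (proj₂ (shrink n i))) (Listₚ.++-assoc (between X i n) _ v)))
  where
  shrink-alt : ∀ n i s → Alternates X s i (n ℕ.+ m) → Alternates X s i n
  shrink-alt zero    i s _         = tt
  shrink-alt (suc n) i s (eq , alt) = eq , shrink-alt n (i + 1ℤ + 1ℤ) (neg s) alt
  shrink : ∀ n i → ∃[ w ] between X i (n ℕ.+ m) ≡ between X i n ++ w
  shrink zero    i = between X i m , refl
  shrink (suc n) i = proj₁ (shrink n (i + 1ℤ + 1ℤ)) , cong (X (i + 1ℤ) ∷_) (proj₂ (shrink n (i + 1ℤ + 1ℤ)))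

-- If both classes alternated, the terms between creases would alternate too, which no folding sequence allows.
creased-exclusive : ∀ X i → Creased X i 4 → ¬ Creased X (i + 1ℤ) 4
creased-exclusive X i (_ , k , S , F , sub) ((s , e₀ , e₁ , e₂ , e₃ , _) , _) =
  no-alternating-Subword s F (subst (λ w → Subword w S) eq sub)
  where
  eq : between X i 4 ≡ s ∷ neg s ∷ s ∷ neg s ∷ []
  eq = cong₂ _∷_ e₀ (cong₂ _∷_ e₁ (cong₂ _∷_ (trans e₂ (neg-involutive s)) (cong (_∷ []) (trans e₃ (cong neg (neg-involutive s))))))

-- The residue class is settled once, by a stretch of four creases at the origin: any longer stretch
-- in the other class would contain four of its creases, against `creased-exclusive`.
creased-all : ∀ X → CompleteFolding X → ∃[ c ] (∀ j n → Creased X (j + j + c) n)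
creased-all X CF = proj₁ origin , ℤ-induction (λ j → ∀ n → Creased X (j + j + c) n) base up down
  where
  origin : ∃[ c ] (∀ n → Creased X c n)
  origin with creased-either X CF 0ℤ 4
  ... | inj₁ C = 0ℤ , λ n → case n (creased-either X CF 0ℤ (n ℕ.+ 4))
    where
    case : ∀ n → Creased X 0ℤ (n ℕ.+ 4) ⊎ Creased X (0ℤ + 1ℤ) (n ℕ.+ 4) → Creased X 0ℤ n
    case n (inj₁ C') = creased-shrink X 4 n _ C'
    case n (inj₂ C') = ⊥-elim (creased-exclusive X 0ℤ C (creased-shrink X n 4 _ (subst (Creased X (0ℤ + 1ℤ)) (ℕₚ.+-comm n 4) C')))
  ... | inj₂ C = 0ℤ + 1ℤ , λ n → case n (creased-either X CF 0ℤ (n ℕ.+ 4))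
    where
    case : ∀ n → Creased X 0ℤ (n ℕ.+ 4) ⊎ Creased X (0ℤ + 1ℤ) (n ℕ.+ 4) → Creased X (0ℤ + 1ℤ) n
    case n (inj₂ C') = creased-shrink X 4 n _ C'
    case n (inj₁ C') = ⊥-elim (creased-exclusive X 0ℤ (creased-shrink X n 4 _ (subst (Creased X 0ℤ) (ℕₚ.+-comm n 4) C')) C)
  c = proj₁ origin
  base : ∀ n → Creased X (0ℤ + 0ℤ + c) n
  base n = subst (λ z → Creased X z n) (sym (ℤₚ.+-identityˡ c)) (proj₂ origin n)
  up : ∀ j → (∀ n → Creased X (j + j + c) n) → ∀ n → Creased X (j + 1ℤ + (j + 1ℤ) + c) n
  up j C n = subst (λ z → Creased X z n) (lem j c) (creased-next X (j + j + c) n (C (suc n)))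
    where
    lem : ∀ j c → j + j + c + 1ℤ + 1ℤ ≡ j + 1ℤ + (j + 1ℤ) + c
    lem = solve-∀
  down : ∀ j → (∀ n → Creased X (j + j + c) n) → ∀ n → Creased X (j - 1ℤ + (j - 1ℤ) + c) n
  -- Five in addition to `n`: the contradiction needs four creases, and `creased-next` uses up one.
  down j C n with creased-either X CF (j - 1ℤ + (j - 1ℤ) + c) (n ℕ.+ 5)
  ... | inj₁ C' = creased-shrink X 5 n _ C'
  ... | inj₂ C' = ⊥-elim (creased-exclusive X (j + j + c) (C 4)
        (subst (λ z → Creased X z 4) (lem j c) (creased-next X _ 4 (creased-shrink X n 5 _ (subst (Creased X _) (ℕₚ.+-comm n 5) C')))))
    where
    lem : ∀ j c → j - 1ℤ + (j - 1ℤ) + c + 1ℤ + 1ℤ + 1ℤ ≡ j + j + c + 1ℤ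
    lem = solve-∀

alternating-node : ∀ (f : ZSeq) → (∀ i → f (i + 1ℤ) ≡ neg (f i)) → ∀ c j h → f (node j h + c) ≡ f c · h
alternating-node f alt c j h = ℤ-induction (λ j → ∀ h → f (node j h + c) ≡ f c · h) base up down j h
  where
  open ≡-Reasoning
  alt² : ∀ i → f (i + 1ℤ + 1ℤ) ≡ f i
  alt² i = trans (alt (i + 1ℤ)) (trans (cong neg (alt i)) (neg-involutive (f i)))
  base : ∀ h → f (node 0ℤ h + c) ≡ f c · h
  base plus  = trans (cong f (ℤₚ.+-identityˡ c)) (·-comm plus (f c))
  base minus = trans (cong f (ℤₚ.+-comm 1ℤ c)) (trans (alt c) (·-comm minus (f c)))
  up : ∀ j → (∀ h → f (node j h + c) ≡ f c · h) → ∀ h → f (node (j + 1ℤ) h + c) ≡ f c · h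
  up j ih h = trans (cong f (lem j (bit h) c)) (trans (alt² (node j h + c)) (ih h))
    where
    lem : ∀ j b c → j + 1ℤ + (j + 1ℤ) + b + c ≡ j + j + b + c + 1ℤ + 1ℤ
    lem = solve-∀
  down : ∀ j → (∀ h → f (node j h + c) ≡ f c · h) → ∀ h → f (node (j - 1ℤ) h + c) ≡ f c · h
  down j ih h = trans (sym (alt² (node (j - 1ℤ) h + c))) (trans (cong f (lem j (bit h) c)) (ih h))
    where
    lem : ∀ j b c → j - 1ℤ + (j - 1ℤ) + b + c + 1ℤ + 1ℤ ≡ j + j + b + c
    lem = solve-∀

module _ (X : ZSeq) (CF : CompleteFolding X) where

  creaseOffset : ℤ
  creaseOffset = proj₁ (creased-all X CF)

  creases-alternate : ∀ i → X (i + 1ℤ + (i + 1ℤ) + creaseOffset) ≡ neg (X (i + i + creaseOffset))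
  creases-alternate i with proj₂ (creased-all X CF) i 2
  ... | (s , e₀ , e₁ , _) , _ = trans (cong X (lem i creaseOffset)) (trans e₁ (cong neg (sym e₀)))
    where
    lem : ∀ i c → i + 1ℤ + (i + 1ℤ) + c ≡ i + i + c + 1ℤ + 1ℤ
    lem = solve-∀

  fold : ZSeq
  fold i = X (i + i + creaseOffset + 1ℤ)

  win-fold : ∀ i n → win fold i n ≡ between X (i + i + creaseOffset) n
  win-fold i zero    = refl
  win-fold i (suc n) = cong (fold i ∷_) (trans (win-fold (i + 1ℤ) n) (cong (λ z → between X z n) (lem i creaseOffset)))
    where
    lem : ∀ i c → i + 1ℤ + (i + 1ℤ) + c ≡ i + i + c + 1ℤ + 1ℤ
    lem = solve-∀

  fold-CompleteFolding : CompleteFolding fold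
  fold-CompleteFolding z m with proj₂ (creased-all X CF) (z + 1ℤ) m
  ... | _ , k , S , F , sub = k , S , F , subst (λ w → Subword w S) (sym (trans (window≡win fold z m) (win-fold (z + 1ℤ) m))) sub

completeFolding-tower : ∀ X → CompleteFolding X → ∃[ e ] Tower e X
-- `e k` is the crease with `j = 0` and `h = plus`; alternation determines the others.
completeFolding-tower X CF = (λ k → level k (off (suc k) + off (suc k) + off k)) , record
  { level  = level
  ; off    = off
  ; bottom = λ _ → refl
  ; crease = λ k → alternating-node (λ i → level k (i + i + off k)) (creases-alternate (level k) (levels-CF k)) (off (suc k))
  ; lift   = λ _ _ → refl
  }
  where
  levels : ℕ → ∃ CompleteFolding
  levels zero    = X , CF
  levels (suc k) = fold (proj₁ (levels k)) (proj₂ (levels k)) , fold-CompleteFolding (proj₁ (levels k)) (proj₂ (levels k))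
  level : ℕ → ZSeq
  level k = proj₁ (levels k)
  levels-CF : ∀ k → CompleteFolding (level k)
  levels-CF k = proj₂ (levels k)
  off : ℕ → ℤ
  off k = creaseOffset (level k) (levels-CF k)

-- Grouping the edges of the lattice into folded pairs

cw : Dir → Dir
cw d = ccw (ccw (ccw d))

opp : Dir → Dir
opp d = ccw (ccw d)

rotate : Sign → Dir → Dir
rotate plus  = ccw
rotate minus = cw

orientation : Dir → Sign
orientation east  = plus
orientation west  = plus
orientation north = minus
orientation south = minus

ccw⁴ : ∀ d → ccw (ccw (ccw (ccw d))) ≡ d
ccw⁴ east  = refl
ccw⁴ north = refl
ccw⁴ west  = refl
ccw⁴ south = refl

rotate-neg : ∀ s d → rotate s (rotate (neg s) d) ≡ d
rotate-neg plus  d = ccw⁴ d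
rotate-neg minus d = ccw⁴ d

rotate-neg′ : ∀ s d → rotate (neg s) (rotate s d) ≡ d
rotate-neg′ plus  d = ccw⁴ d
rotate-neg′ minus d = ccw⁴ d

orientation-rotate : ∀ s d → orientation (rotate s d) ≡ neg (orientation d)
orientation-rotate plus  east  = refl
orientation-rotate plus  north = refl
orientation-rotate plus  west  = refl
orientation-rotate plus  south = refl
orientation-rotate minus east  = refl
orientation-rotate minus north = refl
orientation-rotate minus west  = refl
orientation-rotate minus south = refl

step-opp : ∀ p d → step (step p d) (opp d) ≡ p
step-opp (x , y) east  = cong (_, y) (lem x)
  where
  lem : ∀ x → x + 1ℤ - 1ℤ ≡ x
  lem = solve-∀
step-opp (x , y) west  = cong (_, y) (lem x)
  where
  lem : ∀ x → x - 1ℤ + 1ℤ ≡ x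
  lem = solve-∀
step-opp (x , y) north = cong (x ,_) (lem y)
  where
  lem : ∀ x → x + 1ℤ - 1ℤ ≡ x
  lem = solve-∀
step-opp (x , y) south = cong (x ,_) (lem y)
  where
  lem : ∀ x → x - 1ℤ + 1ℤ ≡ x
  lem = solve-∀

opp-step : ∀ p d → step (step p (opp d)) d ≡ p
opp-step p d = trans (cong (step (step p (opp d))) (sym (ccw⁴ d))) (step-opp p (opp d))

color : Point → Sign
color (x , y) = parity (x + y)

parity-suc : ∀ z → parity (z + 1ℤ) ≡ neg (parity z)
parity-suc z with half z | parity z | halve-spec z
... | i | plus  | refl = cong proj₂ (trans (cong halve (lem i)) (halve-node i minus))
  where
  lem : ∀ i → i + i + 0ℤ + 1ℤ ≡ i + i + 1ℤ
  lem = solve-∀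
... | i | minus | refl = cong proj₂ (trans (cong halve (lem i)) (halve-node (i + 1ℤ) plus))
  where
  lem : ∀ i → i + i + 1ℤ + 1ℤ ≡ i + 1ℤ + (i + 1ℤ) + 0ℤ
  lem = solve-∀

parity-pred : ∀ z → parity (z - 1ℤ) ≡ neg (parity z)
parity-pred z = begin
  parity (z - 1ℤ)                ≡⟨ sym (neg-involutive _) ⟩
  neg (neg (parity (z - 1ℤ)))    ≡⟨ cong neg (sym (parity-suc (z - 1ℤ))) ⟩
  neg (parity (z - 1ℤ + 1ℤ))     ≡⟨ cong (λ w → neg (parity w)) (lem z) ⟩
  neg (parity z)                 ∎
  where
  open ≡-Reasoning
  lem : ∀ z → z - 1ℤ + 1ℤ ≡ z
  lem = solve-∀

color-step : ∀ p d → color (step p d) ≡ neg (color p)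
color-step (x , y) east  = trans (cong parity (lem x y)) (parity-suc (x + y))
  where
  lem : ∀ x y → x + 1ℤ + y ≡ x + y + 1ℤ
  lem = solve-∀
color-step (x , y) north = trans (cong parity (lem x y)) (parity-suc (x + y))
  where
  lem : ∀ x y → x + (y + 1ℤ) ≡ x + y + 1ℤ
  lem = solve-∀
color-step (x , y) west  = trans (cong parity (lem x y)) (parity-pred (x + y))
  where
  lem : ∀ x y → x - 1ℤ + y ≡ x + y - 1ℤ
  lem = solve-∀
color-step (x , y) south = trans (cong parity (lem x y)) (parity-pred (x + y))
  where
  lem : ∀ x y → x + (y - 1ℤ) ≡ x + y - 1ℤ
  lem = solve-∀

-- Multiplication and division by 1 + i; at odd points the division rounds.
twist untwist : Point → Point
twist (x , y) = x - y , x + y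
untwist (x , y) = half (x + y) , y - half (x + y)

halve-twist : ∀ x y → halve (x - y + (x + y)) ≡ (x , plus)
halve-twist x y = trans (cong halve (lem x y)) (halve-node x plus)
  where
  lem : ∀ x y → x - y + (x + y) ≡ x + x + 0ℤ
  lem = solve-∀

color-twist : ∀ p → color (twist p) ≡ plus
color-twist (x , y) = cong proj₂ (halve-twist x y)

untwist-twist : ∀ p → untwist (twist p) ≡ p
untwist-twist (x , y) rewrite halve-twist x y = cong (x ,_) (lem x y)
  where
  lem : ∀ x y → x + y - x ≡ y
  lem = solve-∀

twist-untwist : ∀ p → color p ≡ plus → twist (untwist p) ≡ p
twist-untwist (x , y) even = cong₂ _,_ (trans (lem h y) (trans (cong (_- y) eq) (lem′ x y))) (lem″ h y)
  where
  h = half (x + y)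
  eq : h + h + 0ℤ ≡ x + y
  eq = sym (trans (halve-spec (x + y)) (cong (λ s → h + h + bit s) even))
  lem : ∀ h y → h - (y - h) ≡ h + h + 0ℤ - y
  lem = solve-∀
  lem′ : ∀ x y → x + y - y ≡ x
  lem′ = solve-∀
  lem″ : ∀ h y → h + (y - h) ≡ y
  lem″ = solve-∀

-- (v , d) stands for the unit edge joining the even point (1 + i) v to its neighbour in direction d.
Bond : Set
Bond = Point × Dir

endpoint : Sign → Bond → Point
endpoint plus  (v , d) = twist v
endpoint minus (v , d) = step (twist v) d

color-endpoint : ∀ s x → color (endpoint s x) ≡ s
color-endpoint plus  (v , d) = color-twist v
color-endpoint minus (v , d) = trans (color-step (twist v) d) (cong neg (color-twist v))

-- The two positions of the coarse lattice.  Coordinates are chosen so that the edge base below is always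
-- its own parent: it is the child at its even endpoint for stay and at its odd endpoint for shift.
data Move : Set where
  stay shift : Move

-- The lattice of the coarse edges is placed on the even points of the fine lattice by q ↦ (1 + i) (place q).
place unplace : Sign → Move → Point → Point
place plus  stay  (x , y) = x , y
place minus stay  (x , y) = y , - x
place plus  shift (x , y) = - y , x - 1ℤ
place minus shift (x , y) = 1ℤ - x , - y
unplace plus  stay  (x , y) = x , y
unplace minus stay  (x , y) = - y , x
unplace plus  shift (x , y) = y + 1ℤ , - x
unplace minus shift (x , y) = 1ℤ - x , - y

private
  1-1- : ∀ x → 1ℤ - (1ℤ - x) ≡ x
  1-1- = solve-∀
  -1+1 : ∀ x → x - 1ℤ + 1ℤ ≡ x
  -1+1 = solve-∀
  +1-1 : ∀ x → x + 1ℤ - 1ℤ ≡ x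
  +1-1 = solve-∀

unplace-place : ∀ e m p → unplace e m (place e m p) ≡ p
unplace-place plus  stay  (x , y) = refl
unplace-place minus stay  (x , y) = cong (_, y) (ℤₚ.neg-involutive x)
unplace-place plus  shift (x , y) = cong₂ _,_ (-1+1 x) (ℤₚ.neg-involutive y)
unplace-place minus shift (x , y) = cong₂ _,_ (1-1- x) (ℤₚ.neg-involutive y)

place-unplace : ∀ e m p → place e m (unplace e m p) ≡ p
place-unplace plus  stay  (x , y) = refl
place-unplace minus stay  (x , y) = cong (x ,_) (ℤₚ.neg-involutive y)
place-unplace plus  shift (x , y) = cong₂ _,_ (ℤₚ.neg-involutive x) (+1-1 y)
place-unplace minus shift (x , y) = cong₂ _,_ (1-1- x) (ℤₚ.neg-involutive y)

-- For a fixed colour `s` of a coarse point, a single rotation takes the four coarse edges at it to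
-- their four children.
swing unswing : Sign → Move → Sign → Dir → Dir
swing e stay  plus  d = d
swing e stay  minus d = rotate (neg e) d
swing e shift plus  d = rotate e d
swing e shift minus d = d
unswing e stay  plus  d = d
unswing e stay  minus d = rotate e d
unswing e shift plus  d = rotate (neg e) d
unswing e shift minus d = d

unswing-swing : ∀ e m s d → unswing e m s (swing e m s d) ≡ d
unswing-swing e stay  plus  d = refl
unswing-swing e stay  minus d = rotate-neg e d
unswing-swing e shift plus  d = rotate-neg′ e d
unswing-swing e shift minus d = refl

swing-unswing : ∀ e m s d → swing e m s (unswing e m s d) ≡ d
swing-unswing e stay  plus  d = refl
swing-unswing e stay  minus d = rotate-neg′ e d
swing-unswing e shift plus  d = rotate-neg e d
swing-unswing e shift minus d = refl

child : Sign → Move → Sign → Bond → Bond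
child e m s x = place e m (endpoint s x) , swing e m s (proj₂ x)

side : Sign → Move → Bond → Sign
side e m (v , d) = color (unplace e m v)

-- The edge whose endpoint of colour `s` is `q`, with `d` counted from the even to the odd endpoint;
-- for `minus` the even endpoint lies one step back.
attach : Sign → Point → Dir → Bond
attach plus  q d = untwist q , d
attach minus q d = untwist (step q (opp d)) , d

parent : Sign → Move → Bond → Bond
parent e m (v , d) = attach s q (unswing e m s d)
  where
  q = unplace e m v
  s = color q

endpoint-attach : ∀ s q d → color q ≡ s → endpoint s (attach s q d) ≡ q
endpoint-attach plus  q d eq = twist-untwist q eq
endpoint-attach minus q d eq = trans (cong (λ p → step p d) (twist-untwist (step q (opp d)) (trans (color-step q (opp d)) (cong neg eq))))
                                     (opp-step q d)

attach-direction : ∀ s q d → proj₂ (attach s q d) ≡ d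
attach-direction plus  q d = refl
attach-direction minus q d = refl

attach-endpoint : ∀ s x → attach s (endpoint s x) (proj₂ x) ≡ x
attach-endpoint plus  (v , d) = cong (_, d) (untwist-twist v)
attach-endpoint minus (v , d) = cong (_, d) (trans (cong untwist (step-opp (twist v) d)) (untwist-twist v))

-- A fine edge has exactly one even endpoint, and that is a coarse point. Together with `side-child`
-- and `parent-child` this makes every fine edge a child of exactly one coarse edge, at exactly one
-- end.
child-parent : ∀ e m x → child e m (side e m x) (parent e m x) ≡ x
child-parent e m (v , d) = cong₂ _,_
  (trans (cong (place e m) (endpoint-attach s q _ refl)) (place-unplace e m v))
  (trans (cong (swing e m s) (attach-direction s q _)) (swing-unswing e m s d))
  where
  q = unplace e m v
  s = color q

side-child : ∀ e m s x → side e m (child e m s x) ≡ s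
side-child e m s x = trans (cong color (unplace-place e m (endpoint s x))) (color-endpoint s x)

parent-child : ∀ e m s x → parent e m (child e m s x) ≡ x
parent-child e m s x = trans (cong₂ (λ q r → attach r q (unswing e m r (swing e m s (proj₂ x)))) (unplace-place e m (endpoint s x)) (side-child e m s x))
  (trans (cong (attach s (endpoint s x)) (unswing-swing e m s (proj₂ x))) (attach-endpoint s x))

vec : Dir → Point
vec east  = 1ℤ , 0ℤ
vec north = 0ℤ , 1ℤ
vec west  = - 1ℤ , 0ℤ
vec south = 0ℤ , - 1ℤ

step-vec : ∀ p d → step p d ≡ (proj₁ p + proj₁ (vec d) , proj₂ p + proj₂ (vec d))
step-vec (x , y) east  = cong (x + 1ℤ ,_) (sym (ℤₚ.+-identityʳ y))
step-vec (x , y) north = cong (_, y + 1ℤ) (sym (ℤₚ.+-identityʳ x))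
step-vec (x , y) west  = cong (x - 1ℤ ,_) (sym (ℤₚ.+-identityʳ y))
step-vec (x , y) south = cong (_, y - 1ℤ) (sym (ℤₚ.+-identityʳ x))

vec-ccw : ∀ d → vec (ccw d) ≡ (- proj₂ (vec d) , proj₁ (vec d))
vec-ccw east  = refl
vec-ccw north = refl
vec-ccw west  = refl
vec-ccw south = refl

vec-cw : ∀ d → vec (cw d) ≡ (proj₂ (vec d) , - proj₁ (vec d))
vec-cw east  = refl
vec-cw north = refl
vec-cw west  = refl
vec-cw south = refl

-- The children are two sides of a square whose diagonal is the coarse edge. In complex notation,
-- `stay` with sign `plus` is the identity (1 + i)q + d = (1 + i)(q + d) - id.
children-meet : ∀ e m x → endpoint minus (child e m plus x) ≡ endpoint minus (child e m minus x)
children-meet e m (v , d) = meet e m (twist v) d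
  where
  meet : ∀ e m q d → step (twist (place e m q)) (swing e m plus d) ≡ step (twist (place e m (step q d))) (swing e m minus d)
  meet plus stay q@(x , y) d
    rewrite step-vec q d | step-vec (twist q) d | step-vec (twist (x + proj₁ (vec d) , y + proj₂ (vec d))) (cw d) | vec-cw d
    = cong₂ _,_ (re x y (proj₁ (vec d)) (proj₂ (vec d))) (im x y (proj₁ (vec d)) (proj₂ (vec d)))
    where
    re : ∀ x y a b → x - y + a ≡ x + a - (y + b) + b
    re = solve-∀
    im : ∀ x y a b → x + y + b ≡ x + a + (y + b) + - a
    im = solve-∀
  meet minus stay q@(x , y) d
    rewrite step-vec q d | step-vec (twist (y , - x)) d | step-vec (twist (y + proj₂ (vec d) , - (x + proj₁ (vec d)))) (ccw d) | vec-ccw d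
    = cong₂ _,_ (re x y (proj₁ (vec d)) (proj₂ (vec d))) (im x y (proj₁ (vec d)) (proj₂ (vec d)))
    where
    re : ∀ x y a b → y - - x + a ≡ y + b - - (x + a) + - b
    re = solve-∀
    im : ∀ x y a b → y + - x + b ≡ y + b + - (x + a) + a
    im = solve-∀
  meet plus shift q@(x , y) d
    rewrite step-vec q d | step-vec (twist (- y , x - 1ℤ)) (ccw d) | step-vec (twist (- (y + proj₂ (vec d)) , x + proj₁ (vec d) - 1ℤ)) d | vec-ccw d
    = cong₂ _,_ (re x y (proj₁ (vec d)) (proj₂ (vec d))) (im x y (proj₁ (vec d)) (proj₂ (vec d)))
    where
    re : ∀ x y a b → - y - (x - 1ℤ) + - b ≡ - (y + b) - (x + a - 1ℤ) + a
    re = solve-∀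
    im : ∀ x y a b → - y + (x - 1ℤ) + a ≡ - (y + b) + (x + a - 1ℤ) + b
    im = solve-∀
  meet minus shift q@(x , y) d
    rewrite step-vec q d | step-vec (twist (1ℤ - x , - y)) (cw d) | step-vec (twist (1ℤ - (x + proj₁ (vec d)) , - (y + proj₂ (vec d)))) d | vec-cw d
    = cong₂ _,_ (re x y (proj₁ (vec d)) (proj₂ (vec d))) (im x y (proj₁ (vec d)) (proj₂ (vec d)))
    where
    re : ∀ x y a b → 1ℤ - x - - y + b ≡ 1ℤ - (x + a) - - (y + b) + a
    re = solve-∀
    im : ∀ x y a b → 1ℤ - x + - y + - a ≡ 1ℤ - (x + a) + - (y + b) + b
    im = solve-∀

-- Merging all edges under a common ancestor

record Box (n : ℕ) (p : Point) : Set where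
  constructor box
  field
    ∣x∣≤ : ∣ proj₁ p ∣ ≤ n
    ∣y∣≤ : ∣ proj₂ p ∣ ≤ n

Box-mono : ∀ {m n p} → m ≤ n → Box m p → Box n p
Box-mono m≤n (box a b) = box (ℕₚ.≤-trans a m≤n) (ℕₚ.≤-trans b m≤n)

∣-∣-neg : ∀ {n} x → ∣ x ∣ ≤ n → ∣ - x ∣ ≤ n
∣-∣-neg x = ℕₚ.≤-trans (ℕₚ.≤-reflexive (ℤₚ.∣-i∣≡∣i∣ x))

∣-∣-suc : ∀ {n} x → ∣ x ∣ ≤ n → ∣ x + 1ℤ ∣ ≤ suc n
∣-∣-suc x le = ℕₚ.≤-trans (ℤₚ.∣i+j∣≤∣i∣+∣j∣ x 1ℤ) (ℕₚ.≤-trans (ℕₚ.≤-reflexive (ℕₚ.+-comm ∣ x ∣ 1)) (s≤s le))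

∣-∣-pred : ∀ {n} x → ∣ x ∣ ≤ n → ∣ x - 1ℤ ∣ ≤ suc n
∣-∣-pred x le = ℕₚ.≤-trans (ℤₚ.∣i+j∣≤∣i∣+∣j∣ x (- 1ℤ)) (ℕₚ.≤-trans (ℕₚ.≤-reflexive (ℕₚ.+-comm ∣ x ∣ 1)) (s≤s le))

∣-∣-1- : ∀ {n} x → ∣ x ∣ ≤ n → ∣ 1ℤ - x ∣ ≤ suc n
∣-∣-1- x le = ℕₚ.≤-trans (ℤₚ.∣i+j∣≤∣i∣+∣j∣ 1ℤ (- x)) (s≤s (∣-∣-neg x le))

1+≤ : ∀ {m n} → m ≤ n → m ≤ suc n
1+≤ = ℕₚ.m≤n⇒m≤1+n

∣-∣-resp : ∀ {n x y} → x ≡ y → ∣ x ∣ ≤ n → ∣ y ∣ ≤ n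
∣-∣-resp refl le = le

Box-step : ∀ {n} p d → Box n p → Box (suc n) (step p d)
Box-step (x , y) east  (box a b) = box (∣-∣-suc x a) (1+≤ b)
Box-step (x , y) north (box a b) = box (1+≤ a) (∣-∣-suc y b)
Box-step (x , y) west  (box a b) = box (∣-∣-pred x a) (1+≤ b)
Box-step (x , y) south (box a b) = box (1+≤ a) (∣-∣-pred y b)

Box-twist-step : ∀ {n} p d → Box n (twist p) → Box (suc n) (twist (step p d))
Box-twist-step (x , y) east  (box a b) = box (∣-∣-resp (f x y) (∣-∣-suc (x - y) a)) (∣-∣-resp (g x y) (∣-∣-suc (x + y) b))
  where
  f : ∀ x y → x - y + 1ℤ ≡ x + 1ℤ - y
  f = solve-∀
  g : ∀ x y → x + y + 1ℤ ≡ x + 1ℤ + y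
  g = solve-∀
Box-twist-step (x , y) north (box a b) = box (∣-∣-resp (f x y) (∣-∣-pred (x - y) a)) (∣-∣-resp (g x y) (∣-∣-suc (x + y) b))
  where
  f : ∀ x y → x - y - 1ℤ ≡ x - (y + 1ℤ)
  f = solve-∀
  g : ∀ x y → x + y + 1ℤ ≡ x + (y + 1ℤ)
  g = solve-∀
Box-twist-step (x , y) west  (box a b) = box (∣-∣-resp (f x y) (∣-∣-pred (x - y) a)) (∣-∣-resp (g x y) (∣-∣-pred (x + y) b))
  where
  f : ∀ x y → x - y - 1ℤ ≡ x - 1ℤ - y
  f = solve-∀
  g : ∀ x y → x + y - 1ℤ ≡ x - 1ℤ + y
  g = solve-∀
Box-twist-step (x , y) south (box a b) = box (∣-∣-resp (f x y) (∣-∣-suc (x - y) a)) (∣-∣-resp (g x y) (∣-∣-pred (x + y) b))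
  where
  f : ∀ x y → x - y + 1ℤ ≡ x - (y - 1ℤ)
  f = solve-∀
  g : ∀ x y → x + y - 1ℤ ≡ x + (y - 1ℤ)
  g = solve-∀

Box-unplace : ∀ {n} e m p → Box n p → Box (suc n) (unplace e m p)
Box-unplace plus  stay  (x , y) (box a b) = box (1+≤ a) (1+≤ b)
Box-unplace minus stay  (x , y) (box a b) = box (1+≤ (∣-∣-neg y b)) (1+≤ a)
Box-unplace plus  shift (x , y) (box a b) = box (∣-∣-suc y b) (1+≤ (∣-∣-neg x a))
Box-unplace minus shift (x , y) (box a b) = box (∣-∣-1- x a) (1+≤ (∣-∣-neg y b))

Box-twist-unplace : ∀ {n} e m p → Box n (twist p) → Box (suc n) (twist (unplace e m p))
Box-twist-unplace plus  stay  (x , y) (box a b) = box (1+≤ a) (1+≤ b)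
Box-twist-unplace minus stay  (x , y) (box a b) = box (∣-∣-resp (f x y) (1+≤ (∣-∣-neg (x + y) b))) (∣-∣-resp (g x y) (1+≤ a))
  where
  f : ∀ x y → - (x + y) ≡ - y - x
  f = solve-∀
  g : ∀ x y → x - y ≡ - y + x
  g = solve-∀
Box-twist-unplace plus  shift (x , y) (box a b) = box (∣-∣-resp (f x y) (∣-∣-suc (x + y) b)) (∣-∣-resp (g x y) (∣-∣-1- (x - y) a))
  where
  f : ∀ x y → x + y + 1ℤ ≡ y + 1ℤ - - x
  f = solve-∀
  g : ∀ x y → 1ℤ - (x - y) ≡ y + 1ℤ + - x
  g = solve-∀
Box-twist-unplace minus shift (x , y) (box a b) = box (∣-∣-resp (f x y) (∣-∣-1- (x - y) a)) (∣-∣-resp (g x y) (∣-∣-1- (x + y) b))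
  where
  f : ∀ x y → 1ℤ - (x - y) ≡ 1ℤ - x - - y
  f = solve-∀
  g : ∀ x y → 1ℤ - (x + y) ≡ 1ℤ - x + - y
  g = solve-∀

twist-attach : ∀ s q d → color q ≡ s →
  twist (proj₁ (attach s q d)) ≡ q ⊎ twist (proj₁ (attach s q d)) ≡ step q (opp d)
twist-attach plus  q d eq = inj₁ (twist-untwist q eq)
twist-attach minus q d eq = inj₂ (twist-untwist (step q (opp d)) (trans (color-step q (opp d)) (cong neg eq)))

-- One unit is lost in `unplace` and one in the step back of `attach`.
twist-parent : ∀ {n} e m x → Box n (proj₁ x) → Box (suc (suc n)) (twist (proj₁ (parent e m x)))
twist-parent e m (v , d) b =
  [ (λ eq → subst (Box _) (sym eq) (Box-mono (ℕₚ.n≤1+n _) bq))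
  , (λ eq → subst (Box _) (sym eq) (Box-step q _ bq)) ]′ (twist-attach (color q) q (unswing e m (color q) d) refl)
  where
  q = unplace e m v
  bq = Box-unplace e m v b

twist²-parent : ∀ {n} e m x → Box n (twist (proj₁ x)) → Box (suc (suc n)) (twist (twist (proj₁ (parent e m x))))
twist²-parent e m (v , d) b =
  [ (λ eq → subst (Box _) (cong twist (sym eq)) (Box-mono (ℕₚ.n≤1+n _) bq))
  , (λ eq → subst (Box _) (cong twist (sym eq)) (Box-twist-step q (opp d') bq)) ]′ (twist-attach (color q) q d' refl)
  where
  q = unplace e m v
  d' = unswing e m (color q) d
  bq = Box-twist-unplace e m v b

∣x+x∣ : ∀ x → ∣ x + x ∣ ≡ ∣ x ∣ ℕ.+ ∣ x ∣
∣x+x∣ (+ n)    = refl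
∣x+x∣ -[1+ n ] = cong suc (sym (ℕₚ.+-suc n n))

halve-≤ : ∀ m n → m ℕ.+ m ≤ suc (n ℕ.+ n) → m ≤ n
halve-≤ zero    n       _  = z≤n
halve-≤ (suc m) zero    le with ℕₚ.≤-trans (ℕₚ.≤-reflexive (sym (cong suc (ℕₚ.+-suc m m)))) le
... | s≤s ()
halve-≤ (suc m) (suc n) le with subst₂ _≤_ (cong suc (ℕₚ.+-suc m m)) (cong (λ k → suc (suc k)) (ℕₚ.+-suc n n)) le
... | s≤s (s≤s le') = s≤s (halve-≤ m n le')

-- Two twists multiply by 2i, and integrality absorbs the odd unit.
Box-twist² : ∀ {n} p → Box (suc (n ℕ.+ n)) (twist (twist p)) → Box n p
Box-twist² {n} (x , y) (box a b) = box
  (halve-≤ (∣ x ∣) n (ℕₚ.≤-trans (ℕₚ.≤-reflexive (trans (sym (∣x+x∣ x)) (cong ∣_∣ (f x y)))) b))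
  (halve-≤ (∣ y ∣) n (ℕₚ.≤-trans (ℕₚ.≤-reflexive (trans (sym (∣x+x∣ y)) (trans (sym (ℤₚ.∣-i∣≡∣i∣ (y + y))) (cong ∣_∣ (g x y))))) a))
  where
  f : ∀ x y → x + x ≡ x - y + (x + y)
  f = solve-∀
  g : ∀ x y → - (y + y) ≡ x - y - (x + y)
  g = solve-∀

-- `Box` of `twist v` bounds ∣x∣ + ∣y∣, so this is a square with corners cut off by a diamond. A
-- parent turns a square bound N into the diamond bound N + 2, and a diamond bound N + 2 into the
-- square bound ⌊(N + 4)/2⌋. This map decreases N above 4 and fixes 4, whence the constant.
Octagon : ℕ → Bond → Set
Octagon n (v , _) = Box n v × Box (2 ℕ.+ n) (twist v)

private
  5+n≤ : ∀ n → 4 ℕ.+ (5 ℕ.+ n) ≤ suc ((4 ℕ.+ n) ℕ.+ (4 ℕ.+ n))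
  5+n≤ n = s≤s (ℕₚ.≤-trans (ℕₚ.≤-reflexive (lem n)) (ℕₚ.+-monoʳ-≤ (4 ℕ.+ n) (ℕₚ.m≤m+n 4 n)))
    where
    lem : ∀ n → 8 ℕ.+ n ≡ 4 ℕ.+ n ℕ.+ 4
    lem n = trans (ℕₚ.+-comm 8 n) (trans (sym (ℕₚ.+-assoc n 4 4)) (cong (ℕ._+ 4) (ℕₚ.+-comm n 4)))

Octagon-parent : ∀ e m x → Octagon 4 x → Octagon 4 (parent e m x)
Octagon-parent e m x (b , t) =
  Box-twist² _ (Box-mono (ℕₚ.n≤1+n 8) (twist²-parent e m x t)) , twist-parent e m x b

-- One division by 1 + i only exchanges the square and the diamond; two of them halve the square.
Octagon-parent² : ∀ n e m e' m' x → Octagon (5 ℕ.+ n) x → Octagon (4 ℕ.+ n) (parent e' m' (parent e m x))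
Octagon-parent² n e m e' m' x (b , t) =
  Box-twist² _ (Box-mono (5+n≤ n) (twist²-parent e' m' _ (twist-parent e m x b))) ,
  twist-parent e' m' _ (Box-twist² _ (Box-mono (5+n≤ n) (twist²-parent e m x t)))

inOctagon : ∀ x → ∃[ n ] Octagon (4 ℕ.+ n) x
inOctagon ((x , y) , d) = n , box (grow 4 (ℕₚ.m≤m+n _ _)) (grow 4 (ℕₚ.m≤n+m _ _)) , box (grow 6 (ℤₚ.∣i-j∣≤∣i∣+∣j∣ x y)) (grow 6 (ℤₚ.∣i+j∣≤∣i∣+∣j∣ x y))
  where
  n = ∣ x ∣ ℕ.+ ∣ y ∣
  grow : ∀ k {m} → m ≤ n → m ≤ k ℕ.+ n
  grow k le = ℕₚ.≤-trans le (ℕₚ.m≤n+m n k)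

-- The synchronization game

decode : ℕ → Dir
decode 0 = east
decode 1 = north
decode 2 = west
decode _ = south

encode : Dir → ℕ
encode east  = 0
encode north = 1
encode west  = 2
encode south = 3

decode-encode : ∀ d → decode (encode d) ≡ d
decode-encode east  = refl
decode-encode north = refl
decode-encode west  = refl
decode-encode south = refl

_≟ᵈ_ : DecidableEquality Dir
d ≟ᵈ d' = map′ (λ eq → trans (sym (decode-encode d)) (trans (cong decode eq) (decode-encode d'))) (cong encode) (encode d ℕ.≟ encode d')

_≟ᵇ_ : DecidableEquality Bond
_≟ᵇ_ = ≡-dec (≡-dec ℤₚ._≟_ ℤₚ._≟_) _≟ᵈ_

open DecMembership _≟ᵇ_ using (_∈?_)

_⊆?_ : ∀ X Y → Dec (All (_∈ Y) X)
X ⊆? Y = All.all? (_∈? Y) X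

base : Bond
base = (0ℤ , 0ℤ) , east

-- A finite set of edges is synchronizable if moves can be chosen, each knowing only the current sign,
-- that give all its members the ancestor base.
data Sync : List Bond → Set where
  done   : Sync (base ∷ [])
  play   : ∀ {X} (m : Sign → Move) → (∀ e → Sync (map (parent e (m e)) X)) → Sync X
  weaken : ∀ {X Y} → X ⊆ Y → Sync Y → Sync X

choose : Move → Move → Sign → Move
choose m₊ m₋ plus  = m₊
choose m₊ m₋ minus = m₋

-- One round between explicit sets: the parents need only be contained in sets already won, and
-- these inclusions are decided by evaluation.
advance : ∀ {X} m₊ m₋ {Y₊ Y₋} → Sync Y₊ → Sync Y₋ →
  {True (map (parent plus m₊) X ⊆? Y₊)} → {True (map (parent minus m₋) X ⊆? Y₋)} → Sync X
advance {X} m₊ m₋ {Y₊} {Y₋} s₊ s₋ {c₊} {c₋} = play (choose m₊ m₋) λ where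
  plus  → weaken (All.lookup (toWitness c₊)) s₊
  minus → weaken (All.lookup (toWitness c₋)) s₋

pattern 1- = -[1+ 0 ]
pattern 0+ = + 0
pattern 1+ = + 1

allDirs : List Dir
allDirs = east ∷ north ∷ west ∷ south ∷ []

square : List ℤ → List Bond
square xs = cartesianProduct (cartesianProduct xs xs) allDirs

range₄ range₂ range₁ : List ℤ
range₁ = 1- ∷ 0+ ∷ 1+ ∷ []
range₂ = -[1+ 1 ] ∷ + 2 ∷ range₁
range₄ = -[1+ 3 ] ∷ -[1+ 2 ] ∷ + 3 ∷ + 4 ∷ range₂

-- These sets, and the moves played on them, were found by a search over all sets reachable from square range₄.
pair₁ pair₂ pair₃ pair₄ ring star pinwheel₊ pinwheel₋ cluster : List Bond
pair₁ = base ∷ ((1+ , 0+) , south) ∷ []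
pair₂ = base ∷ ((0+ , 0+) , south) ∷ []
pair₃ = base ∷ ((0+ , 1-) , west) ∷ []
pair₄ = base ∷ ((1+ , 0+) , west) ∷ []
ring = base ∷ ((0+ , 1-) , north) ∷ ((1+ , 1-) , west) ∷ ((1+ , 0+) , south) ∷ []
star = map ((0+ , 0+) ,_) allDirs
pinwheel₊ = ((1- , 0+) , north) ∷ ((0+ , 1-) , west) ∷ ((0+ , 1+) , east) ∷ ((1+ , 0+) , south) ∷ star
pinwheel₋ = ((1- , 0+) , east) ∷ ((0+ , 1-) , north) ∷ ((0+ , 1+) , south) ∷ ((1+ , 0+) , west) ∷ star
cluster =
  ((1- , 1-) , north) ∷ ((1- , 0+) , north) ∷ ((1- , 0+) , east) ∷ ((1- , 1+) , east) ∷
  ((0+ , 1-) , west) ∷ ((0+ , 1-) , north) ∷ ((0+ , 1+) , south) ∷ ((0+ , 1+) , east) ∷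
  ((1+ , 1-) , west) ∷ ((1+ , 0+) , west) ∷ ((1+ , 0+) , south) ∷ ((1+ , 1+) , south) ∷ star

-- The two edges form a right angle at an odd point; for either sign one of the positions makes them
-- the two children of `base`.
sync-pair₁ : Sync pair₁
sync-pair₁ = advance stay shift done done

sync-pair₂ : Sync pair₂
sync-pair₂ = advance shift shift sync-pair₁ sync-pair₁

sync-pair₃ : Sync pair₃
sync-pair₃ = advance stay shift sync-pair₂ sync-pair₁

sync-pair₄ : Sync pair₄
sync-pair₄ = advance stay shift sync-pair₁ sync-pair₂

sync-ring : Sync ring
sync-ring = advance stay stay sync-pair₃ sync-pair₄

sync-star : Sync star
sync-star = advance shift shift sync-ring sync-ring

sync-pinwheel₊ : Sync pinwheel₊
sync-pinwheel₊ = advance stay shift sync-star sync-ring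

sync-pinwheel₋ : Sync pinwheel₋
sync-pinwheel₋ = advance shift stay sync-ring sync-star

sync-cluster : Sync cluster
sync-cluster = advance stay stay sync-pinwheel₊ sync-pinwheel₋

sync-square₁ : Sync (square range₁)
sync-square₁ = play (λ _ → stay) λ where
  plus  → advance stay stay sync-cluster sync-cluster
  minus → advance stay stay sync-cluster sync-cluster

sync-square₂ : Sync (square range₂)
sync-square₂ = play (λ _ → stay) λ where
  plus  → advance stay stay sync-square₁ sync-square₁
  minus → advance stay stay sync-square₁ sync-square₁

-- Two rounds of `stay` roughly halve the coordinates. This crude reduction works down to `range₁`;
-- only then does the choice between the positions matter.
sync-square₄ : Sync (square range₄)
sync-square₄ = play (λ _ → stay) λ where
  plus  → advance stay stay sync-square₂ sync-square₂
  minus → advance stay stay sync-square₂ sync-square₂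

∈-range₄ : ∀ z → ∣ z ∣ ≤ 4 → z ∈ range₄
∈-range₄ (+ 0) _ = there (there (there (there (there (there (there (here refl)))))))
∈-range₄ (+ 1) _ = there (there (there (there (there (there (there (there (here refl))))))))
∈-range₄ (+ 2) _ = there (there (there (there (there (here refl)))))
∈-range₄ (+ 3) _ = there (there (here refl))
∈-range₄ (+ 4) _ = there (there (there (here refl)))
∈-range₄ (+ suc (suc (suc (suc (suc _))))) (s≤s (s≤s (s≤s (s≤s ()))))
∈-range₄ -[1+ 0 ] _ = there (there (there (there (there (there (here refl))))))
∈-range₄ -[1+ 1 ] _ = there (there (there (there (here refl))))
∈-range₄ -[1+ 2 ] _ = there (here refl)
∈-range₄ -[1+ 3 ] _ = here refl
∈-range₄ -[1+ suc (suc (suc (suc _))) ] (s≤s (s≤s (s≤s (s≤s ()))))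

∈-allDirs : ∀ d → d ∈ allDirs
∈-allDirs east  = here refl
∈-allDirs north = there (here refl)
∈-allDirs west  = there (there (here refl))
∈-allDirs south = there (there (there (here refl)))

∈-square₄ : ∀ x → Octagon 4 x → x ∈ square range₄
∈-square₄ ((x , y) , d) (box a b , _) = ∈-cartesianProduct⁺ (∈-cartesianProduct⁺ (∈-range₄ x a) (∈-range₄ y b)) (∈-allDirs d)

-- The covering curve

turn-ccw : ∀ a b → turn (ccw a) (ccw b) ≡ turn a b
turn-ccw east  east  = refl
turn-ccw east  north = refl
turn-ccw east  west  = refl
turn-ccw east  south = refl
turn-ccw north east  = refl
turn-ccw north north = refl
turn-ccw north west  = refl
turn-ccw north south = refl
turn-ccw west  east  = refl
turn-ccw west  north = refl
turn-ccw west  west  = refl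
turn-ccw west  south = refl
turn-ccw south east  = refl
turn-ccw south north = refl
turn-ccw south west  = refl
turn-ccw south south = refl

turn-opp : ∀ a b → turn (opp a) (opp b) ≡ turn a b
turn-opp a b = trans (turn-ccw (ccw a) (ccw b)) (turn-ccw a b)

turn-rotate : ∀ s d → turn d (rotate s d) ≡ s
turn-rotate plus  east  = refl
turn-rotate plus  north = refl
turn-rotate plus  west  = refl
turn-rotate plus  south = refl
turn-rotate minus east  = refl
turn-rotate minus north = refl
turn-rotate minus west  = refl
turn-rotate minus south = refl

opp≡rotate² : ∀ s d → opp d ≡ rotate s (rotate s d)
opp≡rotate² plus  d = refl
opp≡rotate² minus d = cong (λ x → ccw (ccw x)) (sym (ccw⁴ d))

opp-rotate : ∀ s d → opp (rotate s d) ≡ rotate (neg s) d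
opp-rotate plus  d = refl
opp-rotate minus d = cong ccw (ccw⁴ d)

turn-rotated : ∀ s a b → turn (rotate s a) (rotate s b) ≡ turn a b
turn-rotated plus  a b = turn-ccw a b
turn-rotated minus a b = trans (turn-ccw (opp a) (opp b)) (turn-opp a b)

turn-swing : ∀ e m s a b → turn (swing e m s a) (swing e m s b) ≡ turn a b
turn-swing e stay  plus  a b = refl
turn-swing e stay  minus a b = turn-rotated (neg e) a b
turn-swing e shift plus  a b = turn-rotated e a b
turn-swing e shift minus a b = refl

swing-opp : ∀ e m s d → opp (swing e m s d) ≡ swing e m s (opp d)
swing-opp e     stay  plus  d = refl
swing-opp plus  stay  minus d = refl
swing-opp minus stay  minus d = refl
swing-opp plus  shift plus  d = refl
swing-opp minus shift plus  d = refl
swing-opp e     shift minus d = refl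

aim : Sign → Dir → Dir
aim plus  d = d
aim minus d = opp d

orientation-aim : ∀ s d → orientation (aim s d) ≡ orientation d
orientation-aim plus  d     = refl
orientation-aim minus east  = refl
orientation-aim minus north = refl
orientation-aim minus west  = refl
orientation-aim minus south = refl

-- The source of alternating creases: the corner turns by `e` when the coarse edge is traversed from
-- its even endpoint, and by `neg e` from its odd one.
turn-children : ∀ e m h d → turn (swing e m h d) (opp (swing e m (neg h) d)) ≡ e · h
turn-children e stay plus d = begin
  turn d (opp (rotate (neg e) d))     ≡⟨ cong (turn d) (opp-rotate (neg e) d) ⟩
  turn d (rotate (neg (neg e)) d)     ≡⟨ turn-rotate (neg (neg e)) d ⟩
  neg (neg e)                         ≡⟨ trans (neg-involutive e) (sym (·-plus e)) ⟩
  e · plus                            ∎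
  where open ≡-Reasoning
turn-children e stay minus d = begin
  turn (rotate (neg e) d) (opp d)                            ≡⟨ cong (turn (rotate (neg e) d)) (opp≡rotate² (neg e) d) ⟩
  turn (rotate (neg e) d) (rotate (neg e) (rotate (neg e) d)) ≡⟨ turn-rotate (neg e) (rotate (neg e) d) ⟩
  neg e                                                      ≡⟨ sym (·-minus e) ⟩
  e · minus                                                  ∎
  where open ≡-Reasoning
turn-children e shift plus d = begin
  turn (rotate e d) (opp d)                    ≡⟨ cong (turn (rotate e d)) (opp≡rotate² e d) ⟩
  turn (rotate e d) (rotate e (rotate e d))    ≡⟨ turn-rotate e (rotate e d) ⟩
  e                                            ≡⟨ sym (·-plus e) ⟩
  e · plus                                     ∎
  where open ≡-Reasoning
turn-children e shift minus d = begin
  turn d (opp (rotate e d))      ≡⟨ cong (turn d) (opp-rotate e d) ⟩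
  turn d (rotate (neg e) d)      ≡⟨ turn-rotate (neg e) d ⟩
  neg e                          ≡⟨ sym (·-minus e) ⟩
  e · minus                      ∎
  where open ≡-Reasoning

-- Two coarse edges that meet at a point of colour `neg h` undergo the same rotation there, so the
-- turn between them is inherited by their children.
turn-cousins : ∀ e m h a b → turn (opp (swing e m (neg h) a)) (swing e m (neg h) b) ≡ turn (aim h a) (aim (neg h) b)
turn-cousins e m h a b = begin
  turn (opp (swing e m (neg h) a)) (swing e m (neg h) b) ≡⟨ cong (λ x → turn x (swing e m (neg h) b)) (swing-opp e m (neg h) a) ⟩
  turn (swing e m (neg h) (opp a)) (swing e m (neg h) b) ≡⟨ turn-swing e m (neg h) (opp a) b ⟩
  turn (opp a) b                                         ≡⟨ move-opp h ⟩
  turn (aim h a) (aim (neg h) b)                         ∎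
  where
  open ≡-Reasoning
  move-opp : ∀ h → turn (opp a) b ≡ turn (aim h a) (aim (neg h) b)
  move-opp plus  = trans (sym (turn-opp (opp a) b)) (cong (λ x → turn x (opp b)) (ccw⁴ a))
  move-opp minus = refl

toggle : Move → Sign → Sign
toggle stay  p = p
toggle shift p = neg p

orientation-swing : ∀ e m s p d → p · orientation (swing e m s d) ≡ s · toggle m p · orientation d
orientation-swing e stay  plus  p d = refl
orientation-swing e stay  minus p d = trans (cong (p ·_) (orientation-rotate (neg e) d)) (·-neg p (orientation d))
orientation-swing e shift plus  p d = trans (cong (p ·_) (orientation-rotate e d)) (trans (·-neg p (orientation d)) (sym (neg-· p (orientation d))))
orientation-swing e shift minus p d = trans (sym (neg-involutive _)) (cong neg (sym (neg-· p (orientation d))))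

-- The side is `plus` for `stay` and `minus` for `shift`, written in the form in which `branch`
-- produces it.
child-base : ∀ e m p → child e m ((toggle m p · plus) · p) base ≡ base
child-base plus  stay  plus  = refl
child-base plus  stay  minus = refl
child-base plus  shift plus  = refl
child-base plus  shift minus = refl
child-base minus stay  plus  = refl
child-base minus stay  minus = refl
child-base minus shift plus  = refl
child-base minus shift minus = refl

data Eventually (P : ℕ → Set) (k : ℕ) : Set where
  now   : P k → Eventually P k
  later : Eventually P (suc k) → Eventually P k

-- After each synchronization one shift is played, so that shifts occur infinitely often and the curve
-- extends to infinity in both directions.
nextMove : ∀ {X} → Sync X → Sign → Move
nextMove done         e = shift
nextMove (play m _)   e = m e
nextMove (weaken _ s) e = nextMove s e

nextState : ∀ {X} → Sync X → Sign → ∃ Sync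
nextState done         e = _ , sync-square₄
nextState (play m f)   e = _ , f e
nextState (weaken _ s) e = nextState s e

halveℕ-≤ : ∀ n → proj₁ (halveℕ n) ≤ n × proj₁ (halveℕ (suc n)) ≤ n
halveℕ-≤ zero    = z≤n , z≤n
halveℕ-≤ (suc n) = ℕₚ.m≤n⇒m≤1+n (proj₂ (halveℕ-≤ n)) , s≤s (proj₁ (halveℕ-≤ n))

module Covering (e : ℕ → Sign) where

  -- Playing the game along `e`

  state : ℕ → ∃ Sync
  state zero    = _ , sync-square₄
  state (suc k) = nextState (proj₂ (state k)) (e k)

  move : ℕ → Move
  move k = nextMove (proj₂ (state k)) (e k)

  -- Weaker than `state k` being `s`: `weaken` consumes no level, so below it the strategy is no
  -- longer the state but still predicts the same move and the same next state.
  Follows : ∀ {X} → ℕ → Sync X → Set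
  Follows k s = move k ≡ nextMove s (e k) × state (suc k) ≡ nextState s (e k)

  follows : ∀ {k} (t : ∃ Sync) → state k ≡ t → Follows k (proj₂ t)
  follows _ refl = refl , refl

  eventually-restart : ∀ {X} (s : Sync X) k → Follows k s → Eventually (λ j → state j ≡ (_ , sync-square₄)) k
  eventually-restart done         k (_ , eq) = later (now eq)
  eventually-restart (play m f)   k (_ , eq) = later (eventually-restart (f (e k)) (suc k) (follows _ eq))
  eventually-restart (weaken _ s) k F        = eventually-restart s k F

  eventually-shift : ∀ {X} (s : Sync X) k → Follows k s → Eventually (λ j → move j ≡ shift) k
  eventually-shift done         k (eq , _) = now eq
  eventually-shift (play m f)   k (_ , eq) = later (eventually-shift (f (e k)) (suc k) (follows _ eq))
  eventually-shift (weaken _ s) k F        = eventually-shift s k F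

  parentAt : ℕ → Bond → Bond
  parentAt k = parent (e k) (move k)

  data Merges (k : ℕ) (x : Bond) : Set where
    now   : x ≡ base → Merges k x
    later : Merges (suc k) (parentAt k x) → Merges k x

  sync-merges : ∀ {X} (s : Sync X) k → Follows k s → ∀ {x} → x ∈ X → Merges k x
  sync-merges done         k _          (here eq) = now eq
  sync-merges (play m f)   k (eq , eq') {x} x∈X = later (sync-merges (f (e k)) (suc k) (follows _ eq')
    (subst (λ m' → parent (e k) m' x ∈ map (parent (e k) (m (e k))) _) (sym eq) (∈-map⁺ (parent (e k) (m (e k))) x∈X)))
  sync-merges (weaken X⊆Y s) k F x∈X = sync-merges s k F (X⊆Y x∈X)

  -- Level `k` may fall in the middle of a game; until the next one starts, the parents stay inside
  -- the invariant octagon.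
  octagon-merges : ∀ k x → Eventually (λ j → state j ≡ (_ , sync-square₄)) k → Octagon 4 x → Merges k x
  octagon-merges k x (now eq)   o = sync-merges sync-square₄ k (follows _ eq) (∈-square₄ x o)
  octagon-merges k x (later ev) o = later (octagon-merges (suc k) (parentAt k x) ev (Octagon-parent (e k) (move k) x o))

  merges : ∀ k x → Merges k x
  merges k x = contract (proj₁ (inOctagon x)) k x (proj₂ (inOctagon x))
    where
    contract : ∀ n k x → Octagon (4 ℕ.+ n) x → Merges k x
    contract zero    k x o = octagon-merges k x (eventually-restart (proj₂ (state k)) k (refl , refl)) o
    contract (suc n) k x o = later (later (contract n _ _ (Octagon-parent² n (e k) (move k) (e (suc k)) (move (suc k)) x o)))

  -- The rank of `base`, that is, whether it is the first or the second child of itself. Horizontal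
  -- and vertical edges alternate along a curve, so this fixes the ranks of all edges of the level.
  polarity : ℕ → Sign
  polarity zero    = plus
  polarity (suc k) = toggle (move k) (polarity k)

  eventually-polarity : ∀ s k → Eventually (λ j → polarity j ≡ s) k
  eventually-polarity s k = wait k (eventually-shift (proj₂ (state k)) k (refl , refl))
    where
    either : ∀ s j p → polarity j ≡ p → move j ≡ shift → Eventually (λ j → polarity j ≡ s) j
    either plus  j plus  eq _   = now eq
    either minus j minus eq _   = now eq
    either plus  j minus eq eq' = later (now (cong₂ toggle eq' eq))
    either minus j plus  eq eq' = later (now (cong₂ toggle eq' eq))
    wait : ∀ j → Eventually (λ j → move j ≡ shift) j → Eventually (λ j → polarity j ≡ s) j
    wait j (now eq)   = either s j (polarity j) refl eq
    wait j (later ev) = later (wait (suc j) ev)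

  -- plus for the first and minus for the second child, in the order along the curve.
  rank : ℕ → Bond → Sign
  rank k (v , d) = polarity k · orientation d

  rank-child : ∀ k s x → rank k (child (e k) (move k) s x) ≡ s · rank (suc k) x
  rank-child k s (v , d) = orientation-swing (e k) (move k) s (polarity k) d

  branch : ℕ → Sign → Bond → Bond
  branch k h x = child (e k) (move k) (rank (suc k) x · h) x

  rank-branch : ∀ k h x → rank k (branch k h x) ≡ h
  rank-branch k h x = trans (rank-child k (rank (suc k) x · h) x) (·-conjugate (rank (suc k) x) h)

  branch-injective : ∀ k h h' x x' → branch k h x ≡ branch k h' x' → h ≡ h' × x ≡ x'
  branch-injective k h h' x x' eq =
    trans (sym (rank-branch k h x)) (trans (cong (rank k) eq) (rank-branch k h' x')) ,
    trans (sym (parent-child (e k) (move k) _ x)) (trans (cong (parentAt k) eq) (parent-child (e k) (move k) _ x'))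

  branch-parent : ∀ k x → branch k (rank k x) (parentAt k x) ≡ x
  branch-parent k x = trans (cong (λ s → child (e k) (move k) s y) side≡) (child-parent (e k) (move k) x)
    where
    open ≡-Reasoning
    y = parentAt k x
    H = rank (suc k) y
    s = side (e k) (move k) x
    side≡ : H · rank k x ≡ s
    side≡ = begin
      H · rank k x                                 ≡⟨ cong (λ z → H · rank k z) (sym (child-parent (e k) (move k) x)) ⟩
      H · rank k (child (e k) (move k) s y)        ≡⟨ cong (H ·_) (trans (rank-child k s y) (·-comm s H)) ⟩
      H · H · s                                    ≡⟨ ·-self H s ⟩
      s                                            ∎

  branch-base : ∀ k → branch k (polarity k) base ≡ base
  branch-base k = child-base (e k) (move k) (polarity k)

  -- Index of the parent. `base` has index 0 on every level, so the indices are shifted by one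
  -- before halving when `base` is a second child.
  up : ℕ → ℤ → ℤ
  up k z = half (z + bit (polarity k))

  birthRank : ℕ → ℤ → Sign
  birthRank k z = parity (z + bit (polarity k))

  data Reach (k : ℕ) (z : ℤ) : Set where
    now   : z ≡ 0ℤ → Reach k z
    later : Reach (suc k) (up k z) → Reach k z

  -- Halving fixes the index 1 as long as the polarity is `minus`, just as it fixes -1 while it is
  -- `plus`. Both polarities must therefore recur for the numbering to exhaust ℤ.
  reach-+1 : ∀ k → Eventually (λ j → polarity j ≡ plus) k → Reach k 1ℤ
  reach-+1 k (now eq) = later (now (cong (λ p → half (1ℤ + bit p)) eq))
  reach-+1 k (later ev) with polarity k in eq
  ... | plus  = later (now (cong (λ p → half (1ℤ + bit p)) eq))
  ... | minus = later (subst (Reach (suc k)) (cong (λ p → half (1ℤ + bit p)) (sym eq)) (reach-+1 (suc k) ev))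

  reach--1 : ∀ k → Eventually (λ j → polarity j ≡ minus) k → Reach k -[1+ 0 ]
  reach--1 k (now eq) = later (now (cong (λ p → half (-[1+ 0 ] + bit p)) eq))
  reach--1 k (later ev) with polarity k in eq
  ... | minus = later (now (cong (λ p → half (-[1+ 0 ] + bit p)) eq))
  ... | plus  = later (subst (Reach (suc k)) (cong (λ p → half (-[1+ 0 ] + bit p)) (sym eq)) (reach--1 (suc k) ev))

  reach-pos : ∀ n → Acc _<_ n → ∀ k → Reach k (+ n)
  reach-pos zero          _        k = now refl
  reach-pos (suc zero)    _        k = reach-+1 k (eventually-polarity plus k)
  reach-pos (suc (suc n)) (acc rs) k with polarity k in eq
  ... | plus  = later (subst (Reach (suc k)) (sym (trans (cong (λ p → half (+ suc (suc n) + bit p)) eq) (cong half (ℤₚ.+-identityʳ (+ suc (suc n))))))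
                  (reach-pos (suc (proj₁ (halveℕ n))) (rs (s≤s (s≤s (proj₁ (halveℕ-≤ n))))) (suc k)))
  ... | minus = later (subst (Reach (suc k)) (sym (trans (cong (λ p → half (+ suc (suc n) + bit p)) eq) (cong half (ℤₚ.+-comm (+ suc (suc n)) 1ℤ))))
                  (reach-pos (suc (proj₁ (halveℕ (suc n)))) (rs (s≤s (s≤s (proj₂ (halveℕ-≤ n))))) (suc k)))

  reach-neg : ∀ n → Acc _<_ n → ∀ k → Reach k -[1+ n ]
  reach-neg zero    _        k = reach--1 k (eventually-polarity minus k)
  reach-neg (suc n) (acc rs) k with polarity k in eq
  ... | plus  = later (subst (Reach (suc k)) (sym (trans (cong (λ p → half (-[1+ suc n ] + bit p)) eq) (cong half (ℤₚ.+-identityʳ -[1+ suc n ]))))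
                  (reach-neg (proj₁ (halveℕ (suc n))) (rs (s≤s (proj₂ (halveℕ-≤ n)))) (suc k)))
  ... | minus = later (subst (Reach (suc k)) (sym (cong (λ p → half (-[1+ suc n ] + bit p)) eq))
                  (reach-neg (proj₁ (halveℕ n)) (rs (s≤s (proj₁ (halveℕ-≤ n)))) (suc k)))

  reach : ∀ k z → Reach k z
  reach k (+ n)    = reach-pos n (<-wellFounded n) k
  reach k -[1+ n ] = reach-neg n (<-wellFounded n) k

  edge : ∀ {k z} → Reach k z → Bond
  edge (now _)           = base
  edge {k} {z} (later r) = branch k (birthRank k z) (edge r)

  up-0 : ∀ k → up k 0ℤ ≡ 0ℤ
  up-0 k with polarity k
  ... | plus  = refl
  ... | minus = refl

  place-0 : ∀ k → birthRank k 0ℤ ≡ polarity k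
  place-0 k with polarity k
  ... | plus  = refl
  ... | minus = refl

  edge-0 : ∀ {k z} (r : Reach k z) → z ≡ 0ℤ → edge r ≡ base
  edge-0 (now _)       _    = refl
  edge-0 {k} (later r) refl = trans (cong₂ (branch k) (place-0 k) (edge-0 r (up-0 k))) (branch-base k)

  -- Stopping at index 0 or going further up makes no difference, since `base` is its own child with
  -- the rank belonging to index 0.
  edge-unique : ∀ {k z} (r r' : Reach k z) → edge r ≡ edge r'
  edge-unique (now eq)  r'        = sym (edge-0 r' eq)
  edge-unique (later r) (now eq)  = edge-0 (later r) eq
  edge-unique (later r) (later r') = cong (branch _ _) (edge-unique r r')

  curve : ℕ → ℤ → Bond
  curve k z = edge (reach k z)

  curve-up : ∀ k z → curve k z ≡ branch k (birthRank k z) (curve (suc k) (up k z))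
  curve-up k z = edge-unique (reach k z) (later (reach (suc k) (up k z)))

  curve-node : ∀ k i h z → z + bit (polarity k) ≡ node i h → curve k z ≡ branch k h (curve (suc k) i)
  curve-node k i h z eq = trans (curve-up k z) (cong₂ (λ s j → branch k s (curve (suc k) j)) (cong proj₂ halved) (cong proj₁ halved))
    where
    halved : halve (z + bit (polarity k)) ≡ (i , h)
    halved = trans (cong halve eq) (halve-node i h)

  curve-first : ∀ k i → curve k (i + i + - bit (polarity k)) ≡ branch k plus (curve (suc k) i)
  curve-first k i = curve-node k i plus (i + i + - bit (polarity k)) (lem i (bit (polarity k)))
    where
    lem : ∀ i b → i + i + - b + b ≡ i + i + 0ℤ
    lem = solve-∀

  curve-second : ∀ k i → curve k (i + i + - bit (polarity k) + 1ℤ) ≡ branch k minus (curve (suc k) i)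
  curve-second k i = curve-node k i minus (i + i + - bit (polarity k) + 1ℤ) (lem i (bit (polarity k)))
    where
    lem : ∀ i b → i + i + - b + 1ℤ + b ≡ i + i + 1ℤ
    lem = solve-∀

  curve-third : ∀ k i → curve k (i + i + - bit (polarity k) + 1ℤ + 1ℤ) ≡ branch k plus (curve (suc k) (i + 1ℤ))
  curve-third k i = curve-node k (i + 1ℤ) plus (i + i + - bit (polarity k) + 1ℤ + 1ℤ) (lem i (bit (polarity k)))
    where
    lem : ∀ i b → i + i + - b + 1ℤ + 1ℤ + b ≡ i + 1ℤ + (i + 1ℤ) + 0ℤ
    lem = solve-∀

  rank-curve : ∀ k z → rank k (curve k z) ≡ birthRank k z
  rank-curve k z = trans (cong (rank k) (curve-up k z)) (rank-branch k (birthRank k z) (curve (suc k) (up k z)))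

  rank-curve-suc : ∀ k z → rank k (curve k (z + 1ℤ)) ≡ neg (rank k (curve k z))
  rank-curve-suc k z = begin
    rank k (curve k (z + 1ℤ))                ≡⟨ rank-curve k (z + 1ℤ) ⟩
    parity (z + 1ℤ + bit (polarity k))       ≡⟨ cong parity (lem z (bit (polarity k))) ⟩
    parity (z + bit (polarity k) + 1ℤ)       ≡⟨ parity-suc (z + bit (polarity k)) ⟩
    neg (parity (z + bit (polarity k)))      ≡⟨ cong neg (sym (rank-curve k z)) ⟩
    neg (rank k (curve k z))                 ∎
    where
    open ≡-Reasoning
    lem : ∀ z b → z + 1ℤ + b ≡ z + b + 1ℤ
    lem = solve-∀

  -- The ranks met on the way up to `base` are, after the shifts by polarity, the binary digits of
  -- the index.
  curve-surjective : ∀ k x → Merges k x → ∃[ z ] curve k z ≡ x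
  curve-surjective k x (now eq)  = 0ℤ , trans (edge-0 (reach k 0ℤ) refl) (sym eq)
  curve-surjective k x (later m) with curve-surjective (suc k) (parentAt k x) m
  ... | i , eq = node i (rank k x) - bit (polarity k) ,
    trans (curve-node k i (rank k x) _ (lem (node i (rank k x)) (bit (polarity k)))) (trans (cong (branch k (rank k x)) eq) (branch-parent k x))
    where
    lem : ∀ a b → a - b + b ≡ a
    lem = solve-∀

  -- An induction principle for pairs of indices: both become 0 on a common level, because an index
  -- that has reached 0 stays there.
  data Reach₂ (k : ℕ) (z z' : ℤ) : Set where
    now   : z ≡ 0ℤ → z' ≡ 0ℤ → Reach₂ k z z'
    later : Reach₂ (suc k) (up k z) (up k z') → Reach₂ k z z'

  reach₂ : ∀ {k z z'} → Reach k z → Reach k z' → Reach₂ k z z'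
  reach₂ (now eq)  r'         = zeroˡ eq r'
    where
    zeroˡ : ∀ {k z z'} → z ≡ 0ℤ → Reach k z' → Reach₂ k z z'
    zeroˡ eq       (now eq')  = now eq eq'
    zeroˡ {k} refl (later r') = later (zeroˡ (up-0 k) r')
  reach₂ (later r) (now eq')  = zeroʳ (later r) eq'
    where
    zeroʳ : ∀ {k z z'} → Reach k z → z' ≡ 0ℤ → Reach₂ k z z'
    zeroʳ (now eq)      eq'  = now eq eq'
    zeroʳ {k} (later r) refl = later (zeroʳ r (up-0 k))
  reach₂ (later r) (later r') = later (reach₂ r r')

  curve-injective : ∀ k z z' → curve k z ≡ curve k z' → z ≡ z'
  curve-injective k z z' = go (reach₂ (reach k z) (reach k z'))
    where
    go : ∀ {k z z'} → Reach₂ k z z' → curve k z ≡ curve k z' → z ≡ z'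
    go (now refl refl) _  = refl
    go {k} {z} {z'} (later r) eq
      with branch-injective k _ _ _ _ (trans (sym (curve-up k z)) (trans eq (curve-up k z')))
    ... | eq₁ , eq₂ = ∙-cancelʳ ℤₚ.+-0-abelianGroup (bit (polarity k)) z z'
      (trans (halve-spec _) (trans (cong₂ node (go r eq₂) eq₁) (sym (halve-spec _))))

  -- Consecutive edges of the curve

  tail head : ℕ → Bond → Point
  tail k x = endpoint (rank k x) x
  head k x = endpoint (neg (rank k x)) x

  tail-branch : ∀ k x → tail k (branch k plus x) ≡ twist (place (e k) (move k) (tail (suc k) x))
  tail-branch k x = trans (cong (λ h → endpoint h (branch k plus x)) (rank-branch k plus x))
                          (cong (λ s → twist (place (e k) (move k) (endpoint s x))) (·-plus (rank (suc k) x)))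

  head-branch : ∀ k x → head k (branch k minus x) ≡ twist (place (e k) (move k) (head (suc k) x))
  head-branch k x = trans (cong (λ h → endpoint (neg h) (branch k minus x)) (rank-branch k minus x))
                          (cong (λ s → twist (place (e k) (move k) (endpoint s x))) (·-minus (rank (suc k) x)))

  siblings-meet : ∀ k x → head k (branch k plus x) ≡ tail k (branch k minus x)
  siblings-meet k x = begin
    head k (branch k plus x)                                      ≡⟨ cong (λ h → endpoint (neg h) (branch k plus x)) (rank-branch k plus x) ⟩
    endpoint minus (child (e k) (move k) (rank (suc k) x · plus) x)   ≡⟨ meet (rank (suc k) x) ⟩
    endpoint minus (child (e k) (move k) (rank (suc k) x · minus) x)  ≡⟨ cong (λ h → endpoint h (branch k minus x)) (sym (rank-branch k minus x)) ⟩
    tail k (branch k minus x)                                     ∎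
    where
    open ≡-Reasoning
    meet : ∀ s → endpoint minus (child (e k) (move k) (s · plus) x) ≡ endpoint minus (child (e k) (move k) (s · minus) x)
    meet plus  = children-meet (e k) (move k) x
    meet minus = sym (children-meet (e k) (move k) x)

  -- Going up, neighbouring indices stay neighbours until they are siblings, where `siblings-meet`
  -- applies. This must happen, as both finally become 0 on one level.
  curve-connected : ∀ k z → head k (curve k z) ≡ tail k (curve k (z + 1ℤ))
  curve-connected k z = go (reach₂ (reach k z) (reach k (z + 1ℤ))) refl
    where
    open ≡-Reasoning
    go : ∀ {k z z'} → Reach₂ k z z' → z' ≡ z + 1ℤ → head k (curve k z) ≡ tail k (curve k z')
    go (now refl refl) ()
    go {k} {z} {z'} (later r) refl with up k z in eqᵢ | birthRank k z in eqₕ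
    ... | i | plus = begin
      head k (curve k z)                               ≡⟨ cong (head k) (curve-node k i plus z here-eq) ⟩
      head k (branch k plus (curve (suc k) i))         ≡⟨ siblings-meet k (curve (suc k) i) ⟩
      tail k (branch k minus (curve (suc k) i))        ≡⟨ cong (tail k) (sym (curve-node k i minus (z + 1ℤ) next-eq)) ⟩
      tail k (curve k (z + 1ℤ))                        ∎
      where
      here-eq : z + bit (polarity k) ≡ node i plus
      here-eq = trans (halve-spec _) (cong₂ node eqᵢ eqₕ)
      lem : ∀ z b → z + 1ℤ + b ≡ z + b + 1ℤ
      lem = solve-∀
      lem′ : ∀ i → i + i + 0ℤ + 1ℤ ≡ i + i + 1ℤ
      lem′ = solve-∀
      next-eq : z + 1ℤ + bit (polarity k) ≡ node i minus
      next-eq = trans (lem z (bit (polarity k))) (trans (cong (_+ 1ℤ) here-eq) (lem′ i))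
    ... | i | minus = begin
      head k (curve k z)                                                          ≡⟨ cong (head k) (curve-node k i minus z here-eq) ⟩
      head k (branch k minus (curve (suc k) i))                                   ≡⟨ head-branch k (curve (suc k) i) ⟩
      twist (place (e k) (move k) (head (suc k) (curve (suc k) i)))               ≡⟨ cong (λ p → twist (place (e k) (move k) p)) (go r up-next) ⟩
      twist (place (e k) (move k) (tail (suc k) (curve (suc k) (up k (z + 1ℤ))))) ≡⟨ cong (λ j → twist (place (e k) (move k) (tail (suc k) (curve (suc k) j)))) up-next ⟩
      twist (place (e k) (move k) (tail (suc k) (curve (suc k) (i + 1ℤ))))        ≡⟨ sym (tail-branch k (curve (suc k) (i + 1ℤ))) ⟩
      tail k (branch k plus (curve (suc k) (i + 1ℤ)))                             ≡⟨ cong (tail k) (sym (curve-node k (i + 1ℤ) plus (z + 1ℤ) next-eq)) ⟩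
      tail k (curve k (z + 1ℤ))                                                   ∎
      where
      here-eq : z + bit (polarity k) ≡ node i minus
      here-eq = trans (halve-spec _) (cong₂ node eqᵢ eqₕ)
      lem : ∀ z b → z + 1ℤ + b ≡ z + b + 1ℤ
      lem = solve-∀
      lem′ : ∀ i → i + i + 1ℤ + 1ℤ ≡ i + 1ℤ + (i + 1ℤ) + 0ℤ
      lem′ = solve-∀
      next-eq : z + 1ℤ + bit (polarity k) ≡ node (i + 1ℤ) plus
      next-eq = trans (lem z (bit (polarity k))) (trans (cong (_+ 1ℤ) here-eq) (lem′ i))
      up-next : up k (z + 1ℤ) ≡ i + 1ℤ
      up-next = cong proj₁ (trans (cong halve next-eq) (halve-node (i + 1ℤ) plus))

  -- Turns of the curve

  heading : ℕ → Bond → Dir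
  heading k x = aim (rank k x) (proj₂ x)

  turns : ℕ → ZSeq
  turns k z = turn (heading k (curve k z)) (heading k (curve k (z + 1ℤ)))

  turn-siblings : ∀ k x → turn (heading k (branch k plus x)) (heading k (branch k minus x)) ≡ e k · rank (suc k) x
  turn-siblings k x@(v , d) = begin
    turn (heading k (branch k plus x)) (heading k (branch k minus x))
      ≡⟨ cong₂ (λ s t → turn (aim s (proj₂ (branch k plus x))) (aim t (proj₂ (branch k minus x)))) (rank-branch k plus x) (rank-branch k minus x) ⟩
    turn (swing (e k) (move k) (H · plus) d) (opp (swing (e k) (move k) (H · minus) d))
      ≡⟨ cong₂ (λ s t → turn (swing (e k) (move k) s d) (opp (swing (e k) (move k) t d))) (·-plus H) (·-minus H) ⟩
    turn (swing (e k) (move k) H d) (opp (swing (e k) (move k) (neg H) d))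
      ≡⟨ turn-children (e k) (move k) H d ⟩
    e k · H ∎
    where
    open ≡-Reasoning
    H = rank (suc k) x

  turn-branches : ∀ k x y → rank (suc k) y ≡ neg (rank (suc k) x) →
    turn (heading k (branch k minus x)) (heading k (branch k plus y)) ≡ turn (heading (suc k) x) (heading (suc k) y)
  turn-branches k x y eq = begin
    turn (heading k (branch k minus x)) (heading k (branch k plus y))
      ≡⟨ cong₂ (λ s t → turn (aim s (proj₂ (branch k minus x))) (aim t (proj₂ (branch k plus y)))) (rank-branch k minus x) (rank-branch k plus y) ⟩
    turn (opp (swing (e k) (move k) (H · minus) (proj₂ x))) (swing (e k) (move k) (rank (suc k) y · plus) (proj₂ y))
      ≡⟨ cong₂ (λ s t → turn (opp (swing (e k) (move k) s (proj₂ x))) (swing (e k) (move k) t (proj₂ y))) (·-minus H) (trans (·-plus _) eq) ⟩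
    turn (opp (swing (e k) (move k) (neg H) (proj₂ x))) (swing (e k) (move k) (neg H) (proj₂ y))
      ≡⟨ turn-cousins (e k) (move k) H (proj₂ x) (proj₂ y) ⟩
    turn (aim H (proj₂ x)) (aim (neg H) (proj₂ y))
      ≡⟨ cong (λ s → turn (aim H (proj₂ x)) (aim s (proj₂ y))) (sym eq) ⟩
    turn (heading (suc k) x) (heading (suc k) y) ∎
    where
    open ≡-Reasoning
    H = rank (suc k) x

  -- Segments and their supports

  segment : Bond → Segment
  segment x = seg (tail 0 x) (heading 0 x)

  terminal-segment : ∀ x → terminal (segment x) ≡ head 0 x
  terminal-segment x@(v , d) with rank 0 x
  ... | plus  = refl
  ... | minus = step-opp (twist v) d

  positive : Dir → Sign
  positive east  = plus
  positive north = plus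
  positive west  = minus
  positive south = minus

  along : Axis → Sign → Dir
  along horiz plus  = east
  along horiz minus = west
  along vert  plus  = north
  along vert  minus = south

  support-segment : ∀ x → support (segment x) ≡ (endpoint (positive (proj₂ x)) x , axis (proj₂ x))
  support-segment (v , east)  = refl
  support-segment (v , north) = cong (_, vert) (step-opp (twist v) north)
  support-segment (v , west)  = refl
  support-segment (v , south) = refl

  -- `p` is the left or lower endpoint. If it is even, the direction from the even endpoint is the
  -- positive one; if it is odd, the negative one.
  fromEdge : Edge → Bond
  fromEdge (p , a) = attach (color p) p (along a (color p))

  along-axis : ∀ d → along (axis d) (positive d) ≡ d
  along-axis east  = refl
  along-axis north = refl
  along-axis west  = refl
  along-axis south = refl

  positive-along : ∀ a s → positive (along a s) ≡ s
  positive-along horiz plus  = refl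
  positive-along horiz minus = refl
  positive-along vert  plus  = refl
  positive-along vert  minus = refl

  axis-along : ∀ a s → axis (along a s) ≡ a
  axis-along horiz plus  = refl
  axis-along horiz minus = refl
  axis-along vert  plus  = refl
  axis-along vert  minus = refl

  fromEdge-support : ∀ x → fromEdge (support (segment x)) ≡ x
  fromEdge-support x@(v , d) = begin
    fromEdge (support (segment x))                                              ≡⟨ cong fromEdge (support-segment x) ⟩
    attach (color p) p (along (axis d) (color p))                               ≡⟨ cong (λ s → attach s p (along (axis d) s)) (color-endpoint (positive d) x) ⟩
    attach (positive d) p (along (axis d) (positive d))                         ≡⟨ cong (attach (positive d) p) (along-axis d) ⟩
    attach (positive d) p d                                                     ≡⟨ attach-endpoint (positive d) x ⟩
    x                                                                           ∎
    where
    open ≡-Reasoning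
    p = endpoint (positive d) x

  support-fromEdge : ∀ ε → support (segment (fromEdge ε)) ≡ ε
  support-fromEdge (p , a) = begin
    support (segment x)                                ≡⟨ support-segment x ⟩
    (endpoint (positive (proj₂ x)) x , axis (proj₂ x)) ≡⟨ cong (λ d → endpoint (positive d) x , axis d) (attach-direction s p (along a s)) ⟩
    (endpoint (positive (along a s)) x , axis (along a s)) ≡⟨ cong₂ (λ t b → endpoint t x , b) (positive-along a s) (axis-along a s) ⟩
    (endpoint s x , a)                                 ≡⟨ cong (_, a) (endpoint-attach s p (along a s) refl) ⟩
    (p , a)                                            ∎
    where
    open ≡-Reasoning
    s = color p
    x = fromEdge (p , a)

  coveringCurve : Curve
  coveringCurve z = segment (curve 0 z)

  -- The moves affect only the offsets, through the polarity; the signs are the prescribed `e`.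
  tower : Tower e (assocSeq coveringCurve)
  tower = record
    { level  = turns
    ; off    = λ k → - bit (polarity k)
    ; bottom = λ _ → refl
    ; crease = crease
    ; lift   = lift
    }
    where
    open ≡-Reasoning
    cancel : ∀ a b → a + - b + b ≡ a
    cancel = solve-∀
    crease : ∀ k j h → let i = node j h + - bit (polarity (suc k)) in turns k (i + i + - bit (polarity k)) ≡ e k · h
    crease k j h = begin
      turns k (i + i + - bit (polarity k))
        ≡⟨ cong₂ (λ x y → turn (heading k x) (heading k y)) (curve-first k i) (curve-second k i) ⟩
      turn (heading k (branch k plus (curve (suc k) i))) (heading k (branch k minus (curve (suc k) i)))
        ≡⟨ turn-siblings k (curve (suc k) i) ⟩
      e k · rank (suc k) (curve (suc k) i)
        ≡⟨ cong (e k ·_) (trans (cong (rank (suc k)) (curve-node (suc k) j h i (cancel (node j h) (bit (polarity (suc k)))))) (rank-branch (suc k) h (curve (suc (suc k)) j))) ⟩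
      e k · h ∎
      where i = node j h + - bit (polarity (suc k))
    lift : ∀ k i → turns k (i + i + - bit (polarity k) + 1ℤ) ≡ turns (suc k) i
    lift k i = trans
      (cong₂ (λ x y → turn (heading k x) (heading k y)) (curve-second k i) (curve-third k i))
      (turn-branches k (curve (suc k) i) (curve (suc k) (i + 1ℤ)) (rank-curve-suc (suc k) i))

  support-injective : ∀ i j → support (coveringCurve i) ≡ support (coveringCurve j) → i ≡ j
  support-injective i j eq = curve-injective 0 i j
    (trans (sym (fromEdge-support (curve 0 i))) (trans (cong fromEdge eq) (fromEdge-support (curve 0 j))))

  axis-orientation : ∀ d d' → axis d ≡ axis d' → orientation d ≡ orientation d'
  axis-orientation d d' eq = trans (sym (of-axis d)) (trans (cong of eq) (of-axis d'))
    where
    of : Axis → Sign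
    of horiz = plus
    of vert  = minus
    of-axis : ∀ d → of (axis d) ≡ orientation d
    of-axis east  = refl
    of-axis north = refl
    of-axis west  = refl
    of-axis south = refl

  -- Level 0 has polarity `plus`, and reversing a direction keeps its axis. Alternation of ranks
  -- thus makes consecutive segments perpendicular.
  orientation-heading : ∀ x → orientation (heading 0 x) ≡ rank 0 x
  orientation-heading x = orientation-aim (rank 0 x) (proj₂ x)

  isCompleteCurve : IsCompleteCurve coveringCurve
  isCompleteCurve =
    (λ i → trans (terminal-segment (curve 0 i)) (curve-connected 0 i)) ,
    (λ i eq → neg≢ (rank 0 (curve 0 i)) (begin
      neg (rank 0 (curve 0 i))                      ≡⟨ sym (rank-curve-suc 0 i) ⟩
      rank 0 (curve 0 (i + 1ℤ))                     ≡⟨ sym (orientation-heading (curve 0 (i + 1ℤ))) ⟩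
      orientation (heading 0 (curve 0 (i + 1ℤ)))    ≡⟨ axis-orientation _ _ (sym eq) ⟩
      orientation (heading 0 (curve 0 i))           ≡⟨ orientation-heading (curve 0 i) ⟩
      rank 0 (curve 0 i)                            ∎)) ,
    support-injective
    where open ≡-Reasoning

  covers : Covers coveringCurve
  covers ε with curve-surjective 0 (fromEdge ε) (merges 0 (fromEdge ε))
  ... | i , eq = i , hit , λ j eq' → support-injective j i (trans eq' (sym hit))
    where
    hit : support (coveringCurve i) ≡ ε
    hit = trans (cong (λ x → support (segment x)) eq) (support-fromEdge ε)

theorem3p7 : (S : ZSeq) → CompleteFolding S →
    ∃[ D ] (IsCompleteFoldingCurve D × LocallyIso (assocSeq D) S × Covers D)
theorem3p7 S CF = coveringCurve , (isCompleteCurve , TowerProperties.completeFolding tower) , tower-LocallyIso tower (proj₂ decoded) , covers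
  where
  decoded = completeFolding-tower S CF
  open Covering (proj₁ decoded)
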